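{- Let $G$ be a transitive permutation group of degree $d$ which can be generated by $k$ elements. Then there exist an alphabet $A$ with $k$ letters and a finite bifix code $X\subset A^+$ with $\mathrm{Card}(X)=(k-1)d+1$ such that $G$ is (equivalent, as a permutation group, to) a syntactic group of $X$.
   Context: A bifix code is a set of nonempty words none of which is a proper prefix or proper suffix of another. The minimal automaton of a set $L\subset A^*$ has as states the nonempty sets $u^{ -1}L=\{v\mid uv\in L\}$, initial state $L$, and transitions $u^{ -1}L\cdot a=(ua)^{ -1}L$ (undefined if empty); each word $w$ induces a partial map $q\mapsto q\cdot w$ on states, and these maps form the transition monoid. A group in a monoid $M$ is a subsemigroup isomorphic to a group; it is maximal if not contained in another group in $M$. In a monoid of partial maps, all elements of such a group have a common image $I$ and their restrictions to $I$ are permutations, giving a faithful permutation representation on $I$ (the canonical representation). A syntactic group of a prefix code $X$ is the canonical representation of a maximal group in the transition monoid of the minimal automaton of $X^*$. Two permutation groups $G$ on $R$ and $H$ on $S$ are equivalent if there is a bijection $\beta:R\to S$ and an isomorphism $\sigma:G\to H$ with $\beta(rg)=\beta(r)\sigma(g)$ for all $r,g$. The degree of a permutation group is the size of the set it acts on; it is transitive if any point can be mapped to any other. -}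

module Defs where

open import Algebra.Bundles using (Monoid; Group; RawMagma)
open import Algebra.Morphism.Structures using (module MagmaMorphisms; module GroupMorphisms)
open import Data.Fin.Base using (Fin)
open import Data.List.Base using (List; []; _∷_; _++_; _∷ʳ_; concat; length)
open import Data.List.Membership.Propositional using () renaming (_∈_ to _∈ˡ_)
open import Data.List.Properties using (++-assoc; ++-identityʳ; ∷ʳ-++)
open import Data.List.Relation.Binary.Prefix.Heterogeneous using (Prefix)
open import Data.List.Relation.Binary.Suffix.Heterogeneous using (Suffix)
open import Data.List.Relation.Unary.All using (All)
open import Data.List.Relation.Unary.Unique.Propositional using (Unique)
open import Data.Nat.Base using (ℕ)
open import Data.Product.Base using (Σ; ∃; ∃-syntax; Σ-syntax; _×_; _,_; proj₁; proj₂)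
open import Function.Base using (_∘_; _on_)
open import Function.Bundles using (Inverse; _⇔_; mk⇔; module Equivalence)
import Function.Construct.Composition as Composition
import Function.Construct.Identity as Identity
import Function.Construct.Symmetry as Symmetry
open import Level using (Level; 0ℓ; _⊔_) renaming (suc to lsuc)
open import Relation.Binary.Bundles using (Setoid)
open import Relation.Binary.Core using (Rel)
import Relation.Binary.Construct.On as On
open import Relation.Binary.Definitions using (_Respects_)
open import Relation.Binary.PropositionalEquality using (_≡_; _≢_; refl; subst)
import Relation.Binary.PropositionalEquality as ≡
open import Relation.Nullary.Negation using (¬_)
open import Relation.Unary using (Pred; _∈_; _∉_; _⊆_; _≐_; Satisfiable)
open import Relation.Unary.Properties using (≐-refl; ≐-sym; ≐-trans)

private
  variable
    r ℓ p r′ ℓ′ p′ : Level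

-- Permutations act on the right: f ∙ g is "f, then g".

SymmetricGroup : Setoid r ℓ → Group (r ⊔ ℓ) (r ⊔ ℓ)
SymmetricGroup R = record
  { Carrier = Inverse R R
  ; _≈_     = λ f g → ∀ x → Inverse.to f x ≈ Inverse.to g x
  ; _∙_     = Composition.inverse
  ; ε       = Identity.inverse R
  ; _⁻¹     = Symmetry.inverse
  ; isGroup = record
    { isMonoid = record
      { isSemigroup = record
        { isMagma = record
          { isEquivalence = record
            { refl  = λ x → R.refl
            ; sym   = λ e x → R.sym (e x)
            ; trans = λ e f x → R.trans (e x) (f x)
            }
          ; ∙-cong = λ {_} {g} {h} e f x →
              R.trans (Inverse.to-cong h (e x)) (f (Inverse.to g x))
          }
        ; assoc = λ f g h x → R.refl
        }
      ; identity = (λ f x → R.refl) , (λ f x → R.refl)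
      }
    ; inverse = (λ f x → Inverse.strictlyInverseˡ f x)
              , (λ f x → Inverse.strictlyInverseʳ f x)
    ; ⁻¹-cong = λ {f} {g} e x →
        R.trans (R.sym (Inverse.strictlyInverseʳ g (Inverse.from f x)))
          (Inverse.from-cong g
            (R.trans (R.sym (e (Inverse.from f x))) (Inverse.strictlyInverseˡ f x)))
    }
  }
  where
    module R = Setoid R
    open Setoid R using (_≈_)

record Subgroup (G : Group r ℓ) p : Set (r ⊔ ℓ ⊔ lsuc p) where
  open Group G
  field
    Member    : Pred Carrier p
    resp      : Member Respects _≈_
    ε-closed  : ε ∈ Member
    ∙-closed  : ∀ {x y} → x ∈ Member → y ∈ Member → (x ∙ y) ∈ Member
    ⁻¹-closed : ∀ {x} → x ∈ Member → (x ⁻¹) ∈ Member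

  group : Group (r ⊔ p) ℓ
  group = record
    { Carrier = Σ Carrier Member
    ; _≈_     = _≈_ on proj₁
    ; _∙_     = λ (x , x∈) (y , y∈) → x ∙ y , ∙-closed x∈ y∈
    ; ε       = ε , ε-closed
    ; _⁻¹     = λ (x , x∈) → x ⁻¹ , ⁻¹-closed x∈
    ; isGroup = record
      { isMonoid = record
        { isSemigroup = record
          { isMagma = record
            { isEquivalence = On.isEquivalence proj₁ isEquivalence
            ; ∙-cong = ∙-cong
            }
          ; assoc = λ x y z → assoc (proj₁ x) (proj₁ y) (proj₁ z)
          }
        ; identity = identityˡ ∘ proj₁ , identityʳ ∘ proj₁
        }
      ; inverse = inverseˡ ∘ proj₁ , inverseʳ ∘ proj₁
      ; ⁻¹-cong = ⁻¹-cong
      }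
    }

module _ (G : Group r ℓ) where
  open Group G

  data Closure {i} {I : Set i} (g : I → Carrier) : Pred Carrier (i ⊔ r ⊔ ℓ) where
    gen  : ∀ i → Closure g (g i)
    one  : Closure g ε
    mul  : ∀ {x y} → Closure g x → Closure g y → Closure g (x ∙ y)
    neg  : ∀ {x} → Closure g x → Closure g (x ⁻¹)
    conv : Closure g Respects _≈_

-- The k generators form a family, so repetitions are allowed.
GeneratedBy : ℕ → Group r ℓ → Set (r ⊔ ℓ)
GeneratedBy k G = Σ[ g ∈ (Fin k → Group.Carrier G) ] (∀ x → x ∈ Closure G g)

PermutationGroup : Setoid r ℓ → ∀ p → Set (r ⊔ ℓ ⊔ lsuc p)
PermutationGroup R p = Subgroup (SymmetricGroup R) p

module _ {R : Setoid r ℓ} (G : PermutationGroup R p) where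
  open Setoid R

  act : Group.Carrier (Subgroup.group G) → Carrier → Carrier
  act g = Inverse.to (proj₁ g)

  Transitive : Set (r ⊔ ℓ ⊔ p)
  Transitive = ∀ x y → ∃[ g ] act g x ≈ y

HasDegree : Setoid r ℓ → ℕ → Set (r ⊔ ℓ)
HasDegree R d = Inverse R (≡.setoid (Fin d))

record Equivalent {R : Setoid r ℓ} {S : Setoid r′ ℓ′}
                  (G : PermutationGroup R p) (H : PermutationGroup S p′)
                  : Set (r ⊔ ℓ ⊔ p ⊔ r′ ⊔ ℓ′ ⊔ p′) where
  private
    module G = Group (Subgroup.group G)
    module H = Group (Subgroup.group H)
  open GroupMorphisms G.rawGroup H.rawGroup using (IsGroupIsomorphism)
  open Setoid S using (_≈_)
  field
    β           : Inverse R S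
    σ           : G.Carrier → H.Carrier
    σ-iso       : IsGroupIsomorphism σ
    equivariant : ∀ x g → Inverse.to β (act G g x) ≈ act H (σ g) (Inverse.to β x)

record GroupIn (M : Monoid 0ℓ 0ℓ) : Set₁ where
  open Monoid M
  field
    Member   : Pred Carrier 0ℓ
    resp     : Member Respects _≈_
    ∙-closed : ∀ {x y} → x ∈ Member → y ∈ Member → (x ∙ y) ∈ Member

  subsemigroup : RawMagma 0ℓ 0ℓ
  subsemigroup = record
    { Carrier = Σ Carrier Member
    ; _≈_     = _≈_ on proj₁
    ; _∙_     = λ (x , x∈) (y , y∈) → x ∙ y , ∙-closed x∈ y∈
    }

  field
    group : Group 0ℓ 0ℓ
    φ     : Group.Carrier group → Σ Carrier Member
    φ-iso : MagmaMorphisms.IsMagmaIsomorphism (Group.rawMagma group) subsemigroup φ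

  private
    module H = Group group
  open MagmaMorphisms.IsMagmaIsomorphism φ-iso using (surjective; homo; ⟦⟧-cong)

  private
    pre : ∀ {x} → x ∈ Member → H.Carrier
    pre x∈ = proj₁ (surjective (_ , x∈))

    φ-pre : ∀ {x} (x∈ : x ∈ Member) → proj₁ (φ (pre x∈)) ≈ x
    φ-pre x∈ = proj₂ (surjective (_ , x∈)) H.refl

  unit : Carrier
  unit = proj₁ (φ H.ε)

  unit∈ : unit ∈ Member
  unit∈ = proj₂ (φ H.ε)

  inv : ∀ {x} → x ∈ Member → Carrier
  inv x∈ = proj₁ (φ (pre x∈ H.⁻¹))

  inv∈ : ∀ {x} (x∈ : x ∈ Member) → inv x∈ ∈ Member
  inv∈ x∈ = proj₂ (φ (pre x∈ H.⁻¹))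

  unitʳ : ∀ {x} → x ∈ Member → x ∙ unit ≈ x
  unitʳ x∈ = trans (∙-congʳ (sym (φ-pre x∈)))
    (trans (sym (homo _ _)) (trans (⟦⟧-cong (H.identityʳ _)) (φ-pre x∈)))

  invʳ : ∀ {x} (x∈ : x ∈ Member) → x ∙ inv x∈ ≈ unit
  invʳ x∈ = trans (∙-congʳ (sym (φ-pre x∈)))
    (trans (sym (homo _ _)) (⟦⟧-cong (H.inverseʳ _)))

  invˡ : ∀ {x} (x∈ : x ∈ Member) → inv x∈ ∙ x ≈ unit
  invˡ x∈ = trans (∙-congˡ (sym (φ-pre x∈)))
    (trans (sym (homo _ _)) (⟦⟧-cong (H.inverseˡ _)))

Maximal : {M : Monoid 0ℓ 0ℓ} → GroupIn M → Set₁
Maximal {M} Γ = (Δ : GroupIn M) → GroupIn.Member Γ ⊆ GroupIn.Member Δ →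
                GroupIn.Member Δ ⊆ GroupIn.Member Γ

-- The partial transition functions are given by their graphs:
-- "q ─ a ⟶ q′" means that q · a is defined and equal to q′.

record Automaton (A : Set) : Set₁ where
  field
    states : Setoid 0ℓ 0ℓ
  open Setoid states public renaming (Carrier to State) using (_≈_)
  field
    Initial Terminal : Pred State 0ℓ
    _─_⟶_            : State → A → State → Set
    Initial-resp     : Initial Respects _≈_
    Terminal-resp    : Terminal Respects _≈_
    ⟶-resp           : ∀ {q q₁ r r₁ a} → q ≈ q₁ → r ≈ r₁ → q ─ a ⟶ r → q₁ ─ a ⟶ r₁
    ⟶-functional     : ∀ {q r r₁ a} → q ─ a ⟶ r → q ─ a ⟶ r₁ → r ≈ r₁

module TransitionMonoid {A : Set} (𝒜 : Automaton A) where
  open Automaton 𝒜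
  private
    module S = Setoid states

  data _·_↦_ : State → List A → State → Set where
    []  : ∀ {q r} → q ≈ r → q · [] ↦ r
    _∷_ : ∀ {q s r a w} → q ─ a ⟶ s → s · w ↦ r → q · (a ∷ w) ↦ r

  ↦-resp : ∀ {q q₁ r r₁ w} → q ≈ q₁ → r ≈ r₁ → q · w ↦ r → q₁ · w ↦ r₁
  ↦-resp e f ([] g)  = [] (S.trans (S.sym e) (S.trans g f))
  ↦-resp e f (t ∷ p) = ⟶-resp e S.refl t ∷ ↦-resp S.refl f p

  ↦-functional : ∀ {q r r₁ w} → q · w ↦ r → q · w ↦ r₁ → r ≈ r₁
  ↦-functional ([] e)  ([] f)  = S.trans (S.sym e) f
  ↦-functional (t ∷ p) (u ∷ v) =
    ↦-functional p (↦-resp (⟶-functional u t) S.refl v)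

  ↦-++ : ∀ {q s r v w} → q · v ↦ s → s · w ↦ r → q · (v ++ w) ↦ r
  ↦-++ ([] e)  p′ = ↦-resp (S.sym e) S.refl p′
  ↦-++ (t ∷ p) p′ = t ∷ ↦-++ p p′

  ↦-split : ∀ {q r} v {w} → q · (v ++ w) ↦ r → ∃[ s ] q · v ↦ s × s · w ↦ r
  ↦-split []      p       = _ , [] S.refl , p
  ↦-split (_ ∷ v) (t ∷ p) = let s , p₁ , p₂ = ↦-split v p in s , t ∷ p₁ , p₂

  _≋_ : Rel (List A) 0ℓ
  v ≋ w = ∀ {q r} → q · v ↦ r ⇔ q · w ↦ r

  ≡⇒≋ : ∀ {v w} → v ≡ w → v ≋ w
  ≡⇒≋ refl = mk⇔ (λ p → p) (λ p → p)

  -- The set of partial maps induced by words, each presented by a word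
  -- inducing it; words are identified when they induce the same map.
  transitionMonoid : Monoid 0ℓ 0ℓ
  transitionMonoid = record
    { Carrier  = List A
    ; _≈_      = _≋_
    ; _∙_      = _++_
    ; ε        = []
    ; isMonoid = record
      { isSemigroup = record
        { isMagma = record
          { isEquivalence = record
            { refl  = ≡⇒≋ refl
            ; sym   = λ e → Symmetry.equivalence e
            ; trans = λ e f → Composition.equivalence e f
            }
          ; ∙-cong = λ {v} {v₁} {w} {w₁} e f → mk⇔
              (λ p → let _ , p₁ , p₂ = ↦-split v p in
                 ↦-++ (Equivalence.to e p₁) (Equivalence.to f p₂))
              (λ p → let _ , p₁ , p₂ = ↦-split v₁ p in
                 ↦-++ (Equivalence.from e p₁) (Equivalence.from f p₂))
          }
        ; assoc = λ u v w → ≡⇒≋ (++-assoc u v w)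
        }
      ; identity = (λ w → ≡⇒≋ refl) , (λ w → ≡⇒≋ (++-identityʳ w))
      }
    }

  module _ (Γ : GroupIn transitionMonoid) where
    private
      module Γ = GroupIn Γ
      module M = Monoid transitionMonoid

    Image : List A → Pred State 0ℓ
    Image m q = ∃[ s ] s · m ↦ q

    -- `image-common` shows that every element of Γ has this image.
    CommonImage : Pred State 0ℓ
    CommonImage q = ∃[ m ] m ∈ Γ.Member × q ∈ Image m

    fix : ∀ {q} → q ∈ CommonImage → q · Γ.unit ↦ q
    fix (m , m∈ , s , p) =
      let _ , p₁ , p₂ = ↦-split m (Equivalence.from (Γ.unitʳ m∈) p)
      in ↦-resp (↦-functional p₁ p) S.refl p₂

    image-common : ∀ {m} → m ∈ Γ.Member → Image m ≐ CommonImage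
    image-common m∈ = (λ q∈ → _ , m∈ , q∈) , λ q∈ →
      let s , _ , p = ↦-split (Γ.inv m∈) (Equivalence.from (Γ.invˡ m∈) (fix q∈))
      in s , p

    I : Setoid 0ℓ 0ℓ
    I = On.setoid {B = Σ State CommonImage} states proj₁

    private
      module I = Setoid I

    _·⟨_⟩ : ∀ {m} → I.Carrier → m ∈ Γ.Member → I.Carrier
    _·⟨_⟩ {m} (q , q∈) m∈ =
      let s , p , _ = ↦-split m (Equivalence.from (Γ.invʳ m∈) (fix q∈))
      in s , m , m∈ , q , p

    ·⟨⟩-graph : ∀ {m} (x : I.Carrier) (m∈ : m ∈ Γ.Member) →
                proj₁ x · m ↦ proj₁ (x ·⟨ m∈ ⟩)
    ·⟨⟩-graph {m} (q , q∈) m∈ =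
      proj₁ (proj₂ (↦-split m (Equivalence.from (Γ.invʳ m∈) (fix q∈))))

    ·⟨⟩-cong : ∀ {m n} (m∈ : m ∈ Γ.Member) (n∈ : n ∈ Γ.Member) → m ≋ n →
               ∀ {x y} → x I.≈ y → (x ·⟨ m∈ ⟩) I.≈ (y ·⟨ n∈ ⟩)
    ·⟨⟩-cong m∈ n∈ e {x} {y} x≈y =
      ↦-functional (Equivalence.to e (↦-resp x≈y S.refl (·⟨⟩-graph x m∈)))
                   (·⟨⟩-graph y n∈)

    private
      cancel : ∀ {m n} (m∈ : m ∈ Γ.Member) (n∈ : n ∈ Γ.Member) →
               (m ++ n) ≋ Γ.unit → ∀ x → ((x ·⟨ m∈ ⟩) ·⟨ n∈ ⟩) I.≈ x
      cancel m∈ n∈ e x = ↦-functional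
        (Equivalence.to e (↦-++ (·⟨⟩-graph x m∈) (·⟨⟩-graph (x ·⟨ m∈ ⟩) n∈)))
        (fix (proj₂ x))

    restriction : ∀ {m} → m ∈ Γ.Member → Inverse I I
    restriction m∈ = record
      { to        = _·⟨ m∈ ⟩
      ; from      = _·⟨ Γ.inv∈ m∈ ⟩
      ; to-cong   = λ {x} {y} → ·⟨⟩-cong m∈ m∈ M.refl {x} {y}
      ; from-cong = λ {x} {y} → ·⟨⟩-cong (Γ.inv∈ m∈) (Γ.inv∈ m∈) M.refl {x} {y}
      ; inverse   =
          (λ {x} {y} e → S.trans (·⟨⟩-cong m∈ m∈ M.refl {y} {x ·⟨ Γ.inv∈ m∈ ⟩} e)
                                 (cancel (Γ.inv∈ m∈) m∈ (Γ.invˡ m∈) x))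
        , (λ {x} {y} e → S.trans (·⟨⟩-cong (Γ.inv∈ m∈) (Γ.inv∈ m∈) M.refl {y} {x ·⟨ m∈ ⟩} e)
                                 (cancel m∈ (Γ.inv∈ m∈) (Γ.invʳ m∈) x))
      }

    canonicalRepresentation : PermutationGroup I 0ℓ
    canonicalRepresentation = record
      { Member    = λ π → ∃[ m ] Σ[ m∈ ∈ m ∈ Γ.Member ] Sym._≈_ (restriction m∈) π
      ; resp      = λ { {π} {ρ} e (m , m∈ , f) →
          m , m∈ , Sym.trans {restriction m∈} {π} {ρ} f e }
      ; ε-closed  = Γ.unit , Γ.unit∈ , λ x →
          ↦-functional (·⟨⟩-graph x Γ.unit∈) (fix (proj₂ x))
      ; ∙-closed  = λ { {π} {ρ} (m , m∈ , e) (n , n∈ , f) →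
          m ++ n , Γ.∙-closed m∈ n∈ , λ x →
            S.trans (↦-functional (·⟨⟩-graph x (Γ.∙-closed m∈ n∈))
                       (↦-++ (·⟨⟩-graph x m∈) (·⟨⟩-graph (x ·⟨ m∈ ⟩) n∈)))
                    (Sym.∙-cong {restriction m∈} {π} {restriction n∈} {ρ} e f x) }
      ; ⁻¹-closed = λ { {π} (m , m∈ , e) →
          Γ.inv m∈ , Γ.inv∈ m∈ , Sym.⁻¹-cong {restriction m∈} {π} e }
      }
      where module Sym = Group (SymmetricGroup I)

_⁻¹∙_ : {A : Set} → List A → Pred (List A) 0ℓ → Pred (List A) 0ℓ
(u ⁻¹∙ L) v = (u ++ v) ∈ L

-- The state u⁻¹L is presented by the word u (with the nonemptiness of
-- u⁻¹L); two states are equal when they are equal as sets of words.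
minimalAutomaton : {A : Set} → Pred (List A) 0ℓ → Automaton A
minimalAutomaton {A} L = record
  { states        = On.setoid {B = Σ[ u ∈ List A ] Satisfiable (u ⁻¹∙ L)}
                              languages (λ q → proj₁ q ⁻¹∙ L)
  ; Initial       = λ q → (proj₁ q ⁻¹∙ L) ≐ L
  ; Terminal      = λ q → [] ∈ (proj₁ q ⁻¹∙ L)
  ; _─_⟶_         = λ q a r → ((proj₁ q ∷ʳ a) ⁻¹∙ L) ≐ (proj₁ r ⁻¹∙ L)
  ; Initial-resp  = λ e i → ≐-trans (≐-sym e) i
  ; Terminal-resp = λ e → proj₁ e
  ; ⟶-resp        = λ { {u , _} {u₁ , _} {a = a} e f t →
      ≐-trans (∷ʳ-cong u₁ u a (≐-sym e)) (≐-trans t f) }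
  ; ⟶-functional  = λ t t₁ → ≐-trans (≐-sym t) t₁
  }
  where
    languages : Setoid _ _
    languages = record
      { Carrier       = Pred (List A) 0ℓ
      ; _≈_           = _≐_
      ; isEquivalence = record { refl = ≐-refl ; sym = ≐-sym ; trans = ≐-trans }
      }

    ∷ʳ-⊆ : ∀ u v a → (u ⁻¹∙ L) ⊆ (v ⁻¹∙ L) → ((u ∷ʳ a) ⁻¹∙ L) ⊆ ((v ∷ʳ a) ⁻¹∙ L)
    ∷ʳ-⊆ u v a h {w} p = subst L (≡.sym (∷ʳ-++ v a w)) (h (subst L (∷ʳ-++ u a w) p))

    ∷ʳ-cong : ∀ u v a → (u ⁻¹∙ L) ≐ (v ⁻¹∙ L) → ((u ∷ʳ a) ⁻¹∙ L) ≐ ((v ∷ʳ a) ⁻¹∙ L)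
    ∷ʳ-cong u v a (h , k) = ∷ʳ-⊆ u v a h , ∷ʳ-⊆ v u a k

module _ {A : Set} where

  ProperPrefix ProperSuffix : Rel (List A) 0ℓ
  ProperPrefix u v = Prefix _≡_ u v × u ≢ v
  ProperSuffix u v = Suffix _≡_ u v × u ≢ v

  record IsBifixCode (X : Pred (List A) 0ℓ) : Set where
    field
      nonempty    : [] ∉ X
      prefix-free : ∀ {u v} → u ∈ X → v ∈ X → ¬ ProperPrefix u v
      suffix-free : ∀ {u v} → u ∈ X → v ∈ X → ¬ ProperSuffix u v

  HasCard : Pred (List A) 0ℓ → ℕ → Set
  HasCard X n = Σ[ xs ∈ List (List A) ]
    Unique xs × (∀ w → w ∈ X ⇔ w ∈ˡ xs) × length xs ≡ n

  _⋆ : Pred (List A) 0ℓ → Pred (List A) 0ℓ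
  (X ⋆) w = ∃[ xs ] All X xs × concat xs ≡ w

  open TransitionMonoid

  record SyntacticGroup (X : Pred (List A) 0ℓ) : Set₁ where
    field
      Γ       : GroupIn (transitionMonoid (minimalAutomaton (X ⋆)))
      maximal : Maximal Γ

    permutationGroup : PermutationGroup (I (minimalAutomaton (X ⋆)) Γ) 0ℓ
    permutationGroup = canonicalRepresentation (minimalAutomaton (X ⋆)) Γ

{-# OPTIONS --safe #-}

-- Let o be a point and let F be the set of factors of the words s ++ φ y, where φ is an
-- episturmian morphism and s its bispecial word; the code X consists of the words of F
-- labelling first returns to o in the Schreier graph of the generators. The morphism is chosen such
-- that every path labelled s visits o. A word of F with more than one right extension in F
-- then has all k of them, and those that do not return to o are suffixes of s, one for each point v:
-- the suffix P v labels a path from o to v. Counting the leaves of the trie of X by its d branching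
-- nodes gives (k - 1) d + 1. The words φ y permute the states P v of the minimal automaton as they
-- permute the points v, and they realise all of G because φ is an automorphism of the free group.
-- These states are the image of an idempotent φ yₑ that ends with s.

module Submission where

open import Defs
open import Algebra.Bundles using (AbelianGroup; Monoid; Group)
import Algebra.Properties.Group as GroupProperties
open import Data.Fin.Base using (Fin; toℕ; funToFin; finToFun; zero; suc; fromℕ<)
open import Data.Fin.Properties using (any?; all?; pigeonhole; finToFun-funToFin; ¬∀⟶∃¬) renaming (_≟_ to _≟ᶠ_)
open import Data.Integer.Base using (+_; 1ℤ; _+_; _-_; _*_)
import Data.Integer.Properties as ℤ
open import Data.Integer.Tactic.RingSolver using () renaming (solve-∀ to solve-∀ᶻ)
open import Data.List.Base using (List; []; _∷_; [_]; _++_; _∷ʳ_; length; replicate; concat; filter; allFin; map; tabulate)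
open import Data.List.Membership.Propositional using (lose) renaming (_∈_ to _∈ˡ_; _∉_ to _∉ˡ_)
open import Data.List.Membership.Propositional.Properties using (∈-filter⁺; ∈-allFin; ∈-concat⁺′; ∈-concat⁻′; ∈-map⁺; ∈-map⁻; ∈-tabulate⁺; ∈-tabulate⁻)
open import Data.List.Membership.Propositional.Properties.WithK using (unique∧set⇒bag)
open import Data.List.Properties using (++-assoc; ++-identityʳ; ∷ʳ-++; ∷-injective; ∷-injectiveˡ; ∷-injectiveʳ; ++-cancelˡ; length-++; ∷ʳ-injectiveʳ; filter-notAll; ++-identityʳ-unique; ++-conicalˡ; length-map; length-tabulate; ≡-dec)
open import Data.List.Relation.Binary.BagAndSetEquality using (∼bag⇒↭)
open import Data.List.Relation.Binary.Permutation.Propositional.Properties using (↭-length)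
open import Data.List.Relation.Binary.Pointwise using (Pointwise-≡⇒≡)
open import Data.List.Relation.Binary.Prefix.Heterogeneous using (Prefix; []; _∷_)
open import Data.List.Relation.Binary.Suffix.Heterogeneous using (Suffix; here; there)
open import Data.List.Relation.Unary.All using (All; []; _∷_)
import Data.List.Relation.Unary.All as All
import Data.List.Relation.Unary.All.Properties as All
import Data.List.Relation.Unary.AllPairs as AllPairs
import Data.List.Relation.Unary.AllPairs.Properties as AllPairs
open import Data.List.Relation.Unary.Any using (here; there)
open import Data.List.Relation.Unary.Unique.Propositional using (Unique)
import Data.List.Relation.Unary.Unique.Propositional.Properties as Unique
open import Data.Nat.Base using (ℕ; suc; _≤_; _<_; s≤s; z≤n; _^_; zero; NonZero; >-nonZero⁻¹) renaming (_+_ to _+ⁿ_; _*_ to _*ⁿ_)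
open import Data.Nat.Induction using (<-wellFounded)
import Data.Nat.Properties as ℕ
open import Data.Nat.Tactic.RingSolver using (solve-∀)
open import Data.Product.Base using (Σ-syntax; ∃-syntax; _×_; _,_; proj₁; proj₂; Σ)
open import Data.Sum.Base using (_⊎_; inj₁; inj₂)
open import Function.Base using (_∘_; _on_; id)
open import Function.Bundles using (mk⇔; Inverse; _↔_; Injection)
open import Function.Construct.Identity using (↔-id)
open import Function.Properties.Inverse using (Inverse⇒Injection)
open import Induction.WellFounded using (Acc; acc)
open import Level using (Level; 0ℓ)
open import Relation.Binary.Bundles using (Setoid)
import Relation.Binary.Construct.On as On
open import Relation.Binary.Definitions using (DecidableEquality)
open import Relation.Binary.PropositionalEquality using (_≡_; _≢_; refl; sym; trans; cong; cong₂; subst; module ≡-Reasoning; setoid)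
open import Relation.Nullary using (¬_; yes; no; contradiction; Dec; ¬?; _×-dec_)
open import Relation.Unary using (Pred; _≐_; Satisfiable)
open import Relation.Unary.Properties using (≐-refl; ≐-sym; ≐-trans)

-- The first returns to `o` among all words already form a bifix code with the right group, but
-- usually an infinite one: if `a` exchanges two points and `b` fixes both, every word `a b ... b a`
-- is a first return. The restriction to `F D` must be thin enough for finiteness and for the count,
-- yet rich enough to keep all of `G`. Finiteness: a word of `F D` longer than `occurrence-bound D`
-- contains `s D`, which visits `o`, so nonreturning words of `F D` have bounded length. Richness:
-- `y` ranges over all words, so `φ D y` can act as any element of `G`. The leading `s D` in
-- `s D ++ φ D y` is there because this word also ends with `s D`: after any `φ D y` the recent past
-- looks the same again. A suitable `D` exists because, by transitivity, it can be lengthened so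
-- that strictly fewer points have a path labelled `s D` avoiding `o`. The cardinality is computed
-- in the integers to include `k = 0`, where `d = 1` and `X` is empty.

levi : {A : Set} (t p : List A) {t′ p′ : List A} → t ++ p ≡ t′ ++ p′ →
       (∃[ c ] t′ ≡ t ++ c × p ≡ c ++ p′) ⊎ (∃[ c ] t ≡ t′ ++ c × p′ ≡ c ++ p)
levi []      p {t′}     e = inj₁ (t′ , refl , e)
levi (a ∷ t) p {[]}     e = inj₂ (a ∷ t , refl , sym e)
levi (a ∷ t) p {b ∷ t′} e with ∷-injective e
... | refl , e′ with levi t p {t′} e′
...   | inj₁ (c , refl , q) = inj₁ (c , refl , q)
...   | inj₂ (c , refl , q) = inj₂ (c , refl , q)

++-≡-∷ʳ : {A : Set} (c r p : List A) {a : A} → c ++ r ≡ p ∷ʳ a →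
          (c ≡ p ∷ʳ a × r ≡ []) ⊎ (∃[ r′ ] c ++ r′ ≡ p)
++-≡-∷ʳ c r p e with levi c r {p} e
... | inj₁ (c′ , p≡ , _) = inj₂ (c′ , sym p≡)
... | inj₂ ([] , c≡ , _) = inj₂ ([] , trans (++-identityʳ c) (trans c≡ (++-identityʳ p)))
... | inj₂ (_ ∷ [] , c≡ , e′) with ∷-injective e′
...   | refl , r≡ = inj₁ (c≡ , sym r≡)
++-≡-∷ʳ c r p e | inj₂ (_ ∷ _ ∷ _ , c≡ , e′) with ∷-injectiveʳ e′
... | ()

module _ {A : Set} where

  Suf : List A → List A → Set
  Suf p w = ∃[ t ] t ++ p ≡ w

  Suf-++ : ∀ t {p w} → Suf p w → Suf p (t ++ w)
  Suf-++ t {p} (t′ , refl) = t ++ t′ , ++-assoc t t′ p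

-- Episturmian morphisms, their bispecial words and factors.

module Episturmian {A : Set} (_≟_ : DecidableEquality A) where

  pad : A → A → List A
  pad i j with j ≟ i
  ... | yes _ = []
  ... | no  _ = [ i ]

  -- The elementary episturmian morphism sending `i` to `i` and any other letter `j` to `j i`.
  -- Images start with the letter itself; only `pad` depends on `i`.
  ψ : A → List A → List A
  ψ i []      = []
  ψ i (j ∷ w) = j ∷ pad i j ++ ψ i w

  φ : List A → List A → List A
  φ []      w = w
  φ (i ∷ D) w = ψ i (φ D w)

  -- The iterated palindromic closure of `D`: for distinct letters `i`, `j`, `l` it runs through
  -- `i`, `i j i`, `i j i l i j i`.
  s : List A → List A
  s []      = []
  s (i ∷ D) = i ∷ ψ i (s D)

  record F (D p : List A) : Set where
    constructor factor
    field
      y l r : List A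
      eq    : l ++ p ++ r ≡ s D ++ φ D y

  F-factor : ∀ {D} l {p} r → F D (l ++ p ++ r) → F D p
  F-factor l {p} r (factor y l′ r′ e) = factor y (l′ ++ l) (r ++ r′) (begin
    (l′ ++ l) ++ p ++ r ++ r′   ≡⟨ ++-assoc l′ l _ ⟩
    l′ ++ l ++ p ++ r ++ r′     ≡⟨ cong (λ z → l′ ++ l ++ z) (++-assoc p r r′) ⟨
    l′ ++ l ++ (p ++ r) ++ r′   ≡⟨ cong (l′ ++_) (++-assoc l (p ++ r) r′) ⟨
    l′ ++ (l ++ p ++ r) ++ r′   ≡⟨ e ⟩
    _ ∎)
    where open ≡-Reasoning

  F-prefix : ∀ {D} p r → F D (p ++ r) → F D p
  F-prefix p r = F-factor [] r

  F-suffix : ∀ {D} l p → F D (l ++ p) → F D p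
  F-suffix {D} l p f = F-factor l [] (subst (λ z → F D (l ++ z)) (sym (++-identityʳ p)) f)

  ψ-++ : ∀ i v w → ψ i (v ++ w) ≡ ψ i v ++ ψ i w
  ψ-++ i []      w = refl
  ψ-++ i (j ∷ v) w = cong (j ∷_) (trans (cong (pad i j ++_) (ψ-++ i v w)) (sym (++-assoc (pad i j) _ _)))

  φ-++ : ∀ D v w → φ D (v ++ w) ≡ φ D v ++ φ D w
  φ-++ []      v w = refl
  φ-++ (i ∷ D) v w = trans (cong (ψ i) (φ-++ D v w)) (ψ-++ i (φ D v) (φ D w))

  φ-[] : ∀ D → φ D [] ≡ []
  φ-[] []      = refl
  φ-[] (i ∷ D) = cong (ψ i) (φ-[] D)

  φ-∷ : ∀ D a w → ∃[ z ] φ D (a ∷ w) ≡ a ∷ z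
  φ-∷ []      a w = w , refl
  φ-∷ (i ∷ D) a w = let z , e = φ-∷ D a w in pad i a ++ ψ i z , cong (ψ i) e

  φ-∷ʳ : ∀ D i w → φ (D ∷ʳ i) w ≡ φ D (ψ i w)
  φ-∷ʳ []      i w = refl
  φ-∷ʳ (j ∷ D) i w = cong (ψ j) (φ-∷ʳ D i w)

  s-∷ʳ : ∀ D i → s (D ∷ʳ i) ≡ s D ++ φ D [ i ]
  s-∷ʳ []      i = refl
  s-∷ʳ (j ∷ D) i = cong (j ∷_) (trans (cong (ψ j) (s-∷ʳ D i)) (ψ-++ j (s D) _))

  pad-last : ∀ i j → ∃[ t ] i ∷ j ∷ pad i j ≡ t ∷ʳ i
  pad-last i j with j ≟ i
  ... | yes refl = [ i ] , refl
  ... | no  _    = i ∷ j ∷ [] , refl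

  ψ-last : ∀ i w → ∃[ t ] i ∷ ψ i w ≡ t ∷ʳ i
  ψ-last i []      = [] , refl
  ψ-last i (j ∷ w) with pad-last i j | ψ-last i w
  ... | t , e | t′ , e′ = t ++ t′ , (begin
    (i ∷ j ∷ pad i j) ++ ψ i w ≡⟨ cong (_++ ψ i w) e ⟩
    (t ∷ʳ i) ++ ψ i w          ≡⟨ ∷ʳ-++ t i _ ⟩
    t ++ i ∷ ψ i w             ≡⟨ cong (t ++_) e′ ⟩
    t ++ t′ ++ [ i ]           ≡⟨ ++-assoc t t′ _ ⟨
    (t ++ t′) ∷ʳ i ∎)
    where open ≡-Reasoning

  ∷ψ-++ : ∀ i v w → ∃[ t ] i ∷ ψ i (v ++ w) ≡ t ++ i ∷ ψ i w
  ∷ψ-++ i v w = let t , e = ψ-last i v in t ,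
    trans (cong (i ∷_) (ψ-++ i v w)) (trans (cong (_++ ψ i w) e) (∷ʳ-++ t i (ψ i w)))

  -- The word `s D` conjugates `φ D` to a morphism with the padding placed before each letter: for a
  -- single `i`, the initial `i` of `i ∷ ψ i w` travels to the end. Induction on `D` composes these
  -- conjugations.
  s-suffix : ∀ D y → Suf (s D) (s D ++ φ D y)
  s-suffix []      y = y , ++-identityʳ y
  s-suffix (i ∷ D) y with s-suffix D y
  ... | t , e with ∷ψ-++ i t (s D)
  ...   | t′ , e′ = t′ , trans (sym e′) (cong (i ∷_) (trans (cong (ψ i) e) (ψ-++ i (s D) _)))

  Suf-ψ : ∀ i {p w} → Suf p w → Suf (i ∷ ψ i p) (i ∷ ψ i w)
  Suf-ψ i {p} (t , refl) = let t′ , e = ∷ψ-++ i t p in t′ , sym e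

  Suf-∷ : ∀ {p : List A} {a w} → Suf p (a ∷ w) → p ≡ a ∷ w ⊎ Suf p w
  Suf-∷ ([]    , e) = inj₁ e
  Suf-∷ (_ ∷ t , e) = inj₂ (t , ∷-injectiveʳ e)

  s-∈F : ∀ {D p} → Suf p (s D) → ∀ y → F D (p ++ φ D y)
  s-∈F {D} {p} (t , e) y = factor y t [] (begin
    t ++ (p ++ φ D y) ++ [] ≡⟨ cong (t ++_) (++-identityʳ _) ⟩
    t ++ p ++ φ D y         ≡⟨ ++-assoc t p _ ⟨
    (t ++ p) ++ φ D y       ≡⟨ cong (_++ φ D y) e ⟩
    s D ++ φ D y ∎)
    where open ≡-Reasoning

  Suf⇒F : ∀ {D p} → Suf p (s D) → F D p
  Suf⇒F {D} {p} h = subst (F D) (trans (cong (p ++_) (φ-[] D)) (++-identityʳ p)) (s-∈F h [])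

  Suf⇒F∷ʳ : ∀ {D p} → Suf p (s D) → ∀ a → F D (p ∷ʳ a)
  Suf⇒F∷ʳ {D} {p} h a with φ-∷ D a []
  ... | z , e = F-prefix (p ∷ʳ a) z (subst (F D) (trans (cong (p ++_) e) (sym (∷ʳ-++ p a z))) (s-∈F h [ a ]))

  F-extend : ∀ {D p} → A → F D p → ∃[ a ] F D (p ∷ʳ a)
  F-extend {D} {p} b (factor y l (a ∷ r) e) = a , factor y l r (trans (cong (l ++_) (∷ʳ-++ p a r)) e)
  -- Nothing is left to the right of `p`, so `y` is lengthened by `b`, whose image begins with `b`.
  F-extend {D} {p} b (factor y l [] e) with φ-∷ D b []
  ... | z , e′ = b , factor (y ∷ʳ b) l z (begin
    l ++ (p ∷ʳ b) ++ z            ≡⟨ cong (l ++_) (∷ʳ-++ p b z) ⟩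
    l ++ p ++ b ∷ z               ≡⟨ ++-assoc l p _ ⟨
    (l ++ p) ++ b ∷ z             ≡⟨ cong₂ _++_ (trans (cong (l ++_) (sym (++-identityʳ p))) e) (sym e′) ⟩
    (s D ++ φ D y) ++ φ D [ b ]   ≡⟨ ++-assoc (s D) _ _ ⟩
    s D ++ φ D y ++ φ D [ b ]     ≡⟨ cong (s D ++_) (φ-++ D y [ b ]) ⟨
    s D ++ φ D (y ∷ʳ b) ∎)
    where open ≡-Reasoning

  ψ-injective : ∀ i {v w} → ψ i v ≡ ψ i w → v ≡ w
  ψ-injective i {[]}    {[]}    e = refl
  ψ-injective i {j ∷ v} {l ∷ w} e with ∷-injective e
  ... | refl , e′ = cong (j ∷_) (ψ-injective i (++-cancelˡ (pad i j) _ _ e′))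

  ψ-self : ∀ i w → ψ i (i ∷ w) ≡ i ∷ ψ i w
  ψ-self i w with i ≟ i
  ... | yes _  = refl
  ... | no i≢i = contradiction refl i≢i

  -- A cut of `ψ i z` falls between two letter images or splits some `j i` with `j ≢ i`; the second
  -- alternative keeps the `i` left over.
  ψ-suffix : ∀ i z l {m} → l ++ m ≡ ψ i z → ∃[ z₂ ] Suf z₂ z × (m ≡ ψ i z₂ ⊎ m ≡ i ∷ ψ i z₂)
  ψ-suffix i z       []      e = z , ([] , refl) , inj₁ e
  ψ-suffix i (j ∷ z) (x ∷ l) e with j ≟ i
  ... | yes _ = let z₂ , h , m = ψ-suffix i z l (∷-injectiveʳ e) in z₂ , Suf-++ [ j ] h , m
  ψ-suffix i (j ∷ z) (x ∷ [])    e | no _ = z , ([ j ] , refl) , inj₂ (∷-injectiveʳ e)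
  ψ-suffix i (j ∷ z) (x ∷ _ ∷ l) e | no _ =
    let z₂ , h , m = ψ-suffix i z l (∷-injectiveʳ (∷-injectiveʳ e)) in z₂ , Suf-++ [ j ] h , m

  EndsOff : A → List A → Set
  EndsOff i p = ∃[ t ] ∃[ j ] p ≡ t ∷ʳ j × j ≢ i

  EndsOff-++ : ∀ {i} t {p} → EndsOff i p → EndsOff i (t ++ p)
  EndsOff-++ t (t′ , j , refl , j≢i) = t ++ t′ , j , sym (++-assoc t t′ _) , j≢i

  ψ-prefix : ∀ i z p {a r} → p ++ a ∷ r ≡ ψ i z →
             (EndsOff i p × a ≡ i) ⊎ (∃[ q ] ∃[ z′ ] z ≡ q ++ a ∷ z′ × p ≡ ψ i q)
  ψ-prefix i (j ∷ z) []      e with ∷-injectiveˡ e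
  ... | refl = inj₂ ([] , z , refl , refl)
  ψ-prefix i (j ∷ z) (x ∷ p) e with ∷-injective e
  ... | refl , e′ with j ≟ i in eq
  ...   | yes refl with ψ-prefix i z p e′
  ...     | inj₁ (h , a≡i)            = inj₁ (EndsOff-++ [ j ] h , a≡i)
  ...     | inj₂ (q , z′ , refl , p≡) = inj₂ (j ∷ q , z′ , refl , trans (cong (j ∷_) p≡) (sym (ψ-self i q)))
  ψ-prefix i (j ∷ z) (x ∷ [])    e | refl , e′ | no j≢i = inj₁ (([] , j , refl , j≢i) , ∷-injectiveˡ e′)
  ψ-prefix i (j ∷ z) (x ∷ y ∷ p) e | refl , e′ | no j≢i with ∷-injective e′
  ... | refl , e″ with ψ-prefix i z p e″
  ...   | inj₁ (h , a≡i)            = inj₁ (EndsOff-++ (j ∷ i ∷ []) h , a≡i)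
  ...   | inj₂ (q , z′ , refl , p≡) = inj₂ (j ∷ q , z′ , refl , cong (j ∷_) pad-no)
    where
    pad-no : i ∷ p ≡ pad i j ++ ψ i q
    pad-no rewrite eq = cong (i ∷_) p≡

  -- In a word i ∷ ψ i z every letter other than i is followed by i.
  data Desubstituted (i : A) (D p : List A) (a : A) : Set where
    empty : p ≡ [] → Desubstituted i D p a
    off   : EndsOff i p → a ≡ i → Desubstituted i D p a
    image : ∀ q → F D (q ∷ʳ a) → p ≡ ψ i q ⊎ p ≡ i ∷ ψ i q → Desubstituted i D p a

  desubstitute : ∀ {i D p a} → F (i ∷ D) (p ∷ʳ a) → Desubstituted i D p a
  desubstitute {i} {D} {p} {a} (factor y l r e) with trans (cong (l ++_) (sym (∷ʳ-++ p a r))) (trans e (cong (i ∷_) (sym (ψ-++ i (s D) (φ D y)))))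
  ... | e′ = start l e′
    where
    z = s D ++ φ D y

    factor′ : ∀ {z₂ q z′} → Suf z₂ z → z₂ ≡ q ++ a ∷ z′ → F D (q ∷ʳ a)
    factor′ {_} {q} {z′} (t , h) refl = factor y t z′ (trans (cong (t ++_) (∷ʳ-++ q a z′)) h)

    start : ∀ l → l ++ p ++ a ∷ r ≡ i ∷ ψ i z → Desubstituted i D p a
    within : ∀ {z₂} → Suf z₂ z → ∀ p′ → p′ ++ a ∷ r ≡ ψ i z₂ → p ≡ p′ ⊎ p ≡ i ∷ p′ → Desubstituted i D p a
    within {z₂} h p′ e₂ p≡ with ψ-prefix i z₂ p′ e₂
    within h p′ e₂ (inj₁ refl) | inj₁ (off′ , a≡i) = off off′ a≡i
    within h p′ e₂ (inj₂ refl) | inj₁ (off′ , a≡i) = off (EndsOff-++ [ i ] off′) a≡i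
    within h p′ e₂ (inj₁ refl) | inj₂ (q , z′ , z≡ , p′≡) = image q (factor′ h z≡) (inj₁ p′≡)
    within h p′ e₂ (inj₂ refl) | inj₂ (q , z′ , z≡ , p′≡) = image q (factor′ h z≡) (inj₂ (cong (i ∷_) p′≡))

    marked : ∀ {z₂} → Suf z₂ z → ∀ p′ → p ≡ p′ → p′ ++ a ∷ r ≡ i ∷ ψ i z₂ → Desubstituted i D p a
    marked h []       p≡ e₂ = empty p≡
    marked h (x ∷ p′) p≡ e₂ with ∷-injective e₂
    ... | refl , e₃ = within h p′ e₃ (inj₂ p≡)

    start [] e₁ = marked ([] , refl) p refl e₁
    start (x ∷ l) e₁ with ψ-suffix i z l (∷-injectiveʳ e₁)
    ... | z₂ , h , inj₁ m = within h p m (inj₁ refl)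
    ... | z₂ , h , inj₂ m = marked h p refl m

  ¬EndsOff-ψ : ∀ {i p q} → p ≡ ψ i q ⊎ p ≡ i ∷ ψ i q → ¬ EndsOff i p
  ¬EndsOff-ψ {i} {p} {q} c h with EndsOff-i∷ c
    where
    EndsOff-i∷ : p ≡ ψ i q ⊎ p ≡ i ∷ ψ i q → EndsOff i (i ∷ ψ i q)
    EndsOff-i∷ (inj₁ e) = subst (λ z → EndsOff i (i ∷ z)) e (EndsOff-++ [ i ] h)
    EndsOff-i∷ (inj₂ e) = subst (EndsOff i) e h
  ... | t , j , e , j≢i = let t′ , e′ = ψ-last i q in
    j≢i (∷ʳ-injectiveʳ t t′ (trans (sym e) e′))

  -- Induction on `D`: two different letters can follow a nonempty `p` only if it desubstitutes for
  -- both of them, and then a preimage also has two right extensions. `Suf-ψ` lifts the comparison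
  -- with `s D` to `s (i ∷ D)`.
  bispecial : ∀ D {p a b} → a ≢ b → F D (p ∷ʳ a) → F D (p ∷ʳ b) → Suf p (s D) ⊎ Suf (s D) p
  bispecial []      {p} a≢b fa fb = inj₂ (p , ++-identityʳ p)
  bispecial (i ∷ D) {p} {a} {b} a≢b fa fb with desubstitute fa | desubstitute fb
  ... | empty refl | _          = inj₁ (i ∷ ψ i (s D) , ++-identityʳ _)
  ... | off _ _    | empty refl = inj₁ (i ∷ ψ i (s D) , ++-identityʳ _)
  ... | off _ a≡i  | off _ b≡i  = contradiction (trans a≡i (sym b≡i)) a≢b
  ... | off h _    | image _ _ e = contradiction h (¬EndsOff-ψ e)
  ... | image q _ _ | empty refl = inj₁ (i ∷ ψ i (s D) , ++-identityʳ _)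
  ... | image q _ e | off h _   = contradiction h (¬EndsOff-ψ e)
  ... | image q f e | image q′ f′ e′ = combine e e′
    where
    shifted : F D (q ∷ʳ a) → F D (q ∷ʳ b) → p ≡ ψ i q → Suf p (s (i ∷ D)) ⊎ Suf (s (i ∷ D)) p
    shifted f₁ f₂ refl with bispecial D a≢b f₁ f₂
    ... | inj₁ h = inj₁ (let t , h′ = Suf-ψ i h in t ∷ʳ i , trans (∷ʳ-++ t i _) h′)
    -- Removing the leading `i` of `i ∷ ψ i q` keeps the suffix `s (i ∷ D)`, unless that is the
    -- whole word; then `p` is a suffix of it instead.
    ... | inj₂ h with Suf-∷ (Suf-ψ i h)
    ...   | inj₁ e₁ = inj₁ ([ i ] , sym e₁)
    ...   | inj₂ h₁ = inj₂ h₁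

    exact : ∀ q → F D (q ∷ʳ a) → F D (q ∷ʳ b) → p ≡ i ∷ ψ i q → Suf p (s (i ∷ D)) ⊎ Suf (s (i ∷ D)) p
    exact q f₁ f₂ refl with bispecial D a≢b f₁ f₂
    ... | inj₁ h = inj₁ (Suf-ψ i h)
    ... | inj₂ h = inj₂ (Suf-ψ i h)

    combine : p ≡ ψ i q ⊎ p ≡ i ∷ ψ i q → p ≡ ψ i q′ ⊎ p ≡ i ∷ ψ i q′ → Suf p (s (i ∷ D)) ⊎ Suf (s (i ∷ D)) p
    combine (inj₁ e₁) (inj₁ e₂) = shifted f (subst (λ z → F D (z ∷ʳ b)) (ψ-injective i (trans (sym e₂) e₁)) f′) e₁
    combine (inj₂ e₁) (inj₂ e₂) =
      exact q f (subst (λ z → F D (z ∷ʳ b)) (ψ-injective i (∷-injectiveʳ (trans (sym e₂) e₁))) f′) e₁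
    -- Here `ψ i q ≡ i ∷ ψ i q′` forces `q ≡ i ∷ q′`; dropping this `i` makes `q′` a common
    -- preimage.
    combine (inj₁ e₁) (inj₂ e₂) = exact q′
      (F-suffix [ i ] _ (subst (λ z → F D (z ∷ʳ a)) (ψ-injective i (trans (sym e₁) (trans e₂ (sym (ψ-self i q′))))) f)) f′ e₂
    combine (inj₂ e₁) (inj₁ e₂) = exact q f
      (F-suffix [ i ] _ (subst (λ z → F D (z ∷ʳ b)) (ψ-injective i (trans (sym e₂) (trans e₁ (sym (ψ-self i q))))) f′)) e₁

  ψ-length : ∀ i w → length (ψ i w) ≤ 2 *ⁿ length w
  ψ-length i []      = z≤n
  ψ-length i (j ∷ w) with j ≟ i
  ... | yes _ = ℕ.≤-trans (s≤s (ψ-length i w)) (ℕ.≤-trans (ℕ.n≤1+n _) (ℕ.≤-reflexive (sym (ℕ.*-suc 2 (length w)))))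
  ... | no  _ = ℕ.≤-trans (s≤s (s≤s (ψ-length i w))) (ℕ.≤-reflexive (sym (ℕ.*-suc 2 (length w))))

  φ-length : ∀ D w → length (φ D w) ≤ 2 ^ length D *ⁿ length w
  φ-length []      w = ℕ.≤-reflexive (sym (ℕ.+-identityʳ _))
  φ-length (i ∷ D) w = ℕ.≤-trans (ψ-length i (φ D w))
    (ℕ.≤-trans (ℕ.*-monoʳ-≤ 2 (φ-length D w)) (ℕ.≤-reflexive (sym (ℕ.*-assoc 2 (2 ^ length D) _))))

  -- Consecutive occurrences of `s D` in `s D ++ φ D y` start at most `2 ^ length D` apart, the
  -- bound on the image of one letter. A window longer than this plus `length (s D)` contains one.
  occurrence-bound : List A → ℕ
  occurrence-bound D = 2 ^ length D +ⁿ length (s D)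

  s-occurs : ∀ {D p} → F D p → occurrence-bound D < length p → ∃[ l ] ∃[ r ] l ++ s D ++ r ≡ p
  s-occurs {D} {p} (factor y l r e) = go y l e
    where
    go : ∀ y l → l ++ p ++ r ≡ s D ++ φ D y → occurrence-bound D < length p → ∃[ l ] ∃[ r ] l ++ s D ++ r ≡ p
    go [] l e N<p = contradiction (ℕ.≤-trans p≤ (ℕ.m≤n+m (length (s D)) (2 ^ length D))) (ℕ.<⇒≱ N<p)
      where
      open ℕ.≤-Reasoning
      p≤ : length p ≤ length (s D)
      p≤ = begin
        length p                         ≤⟨ ℕ.m≤m+n (length p) (length r) ⟩
        length p +ⁿ length r             ≡⟨ length-++ p ⟨
        length (p ++ r)                  ≤⟨ ℕ.m≤n+m _ (length l) ⟩
        length l +ⁿ length (p ++ r)      ≡⟨ length-++ l ⟨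
        length (l ++ p ++ r)             ≡⟨ cong length e ⟩
        length (s D ++ φ D [])           ≡⟨ cong (λ z → length (s D ++ z)) (φ-[] D) ⟩
        length (s D ++ [])               ≡⟨ cong length (++-identityʳ (s D)) ⟩
        length (s D) ∎
    -- The word is also `t ++ s D ++ φ D y`. Either the window starts after `t` and `y` gets
    -- shorter, or this `s D` lies in the window, or it reaches the end of a window that is then too
    -- short.
    go (a ∷ y) l e N<p with s-suffix D [ a ]
    ... | t , t-eq with levi l (p ++ r) {t} {s D ++ φ D y} (trans e shift)
      where
      open ≡-Reasoning
      shift : s D ++ φ D (a ∷ y) ≡ t ++ s D ++ φ D y
      shift = begin
        s D ++ φ D (a ∷ y)          ≡⟨ cong (s D ++_) (φ-++ D [ a ] y) ⟩
        s D ++ φ D [ a ] ++ φ D y   ≡⟨ ++-assoc (s D) _ _ ⟨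
        (s D ++ φ D [ a ]) ++ φ D y ≡⟨ cong (_++ φ D y) t-eq ⟨
        (t ++ s D) ++ φ D y         ≡⟨ ++-assoc t _ _ ⟩
        t ++ s D ++ φ D y ∎
    ...   | inj₂ (c , l≡ , e₂) = go y c (sym e₂) N<p
    ...   | inj₁ (c , t≡ , e₂) with levi p r {c ++ s D} (trans e₂ (sym (++-assoc c _ _)))
    ...     | inj₂ (c′ , p≡ , _) = c , c′ , trans (sym (++-assoc c _ _)) (sym p≡)
    ...     | inj₁ (c′ , cs≡ , _) = contradiction p≤ (ℕ.<⇒≱ N<p)
      where
      open ℕ.≤-Reasoning
      t-length : length t ≤ 2 ^ length D
      t-length = ℕ.+-cancelʳ-≤ (length (s D)) _ _ (begin
        length t +ⁿ length (s D)          ≡⟨ length-++ t ⟨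
        length (t ++ s D)                 ≡⟨ cong length t-eq ⟩
        length (s D ++ φ D [ a ])         ≡⟨ length-++ (s D) ⟩
        length (s D) +ⁿ length (φ D [ a ]) ≡⟨ ℕ.+-comm (length (s D)) _ ⟩
        length (φ D [ a ]) +ⁿ length (s D) ≤⟨ ℕ.+-monoˡ-≤ (length (s D)) (φ-length D [ a ]) ⟩
        2 ^ length D *ⁿ 1 +ⁿ length (s D)  ≡⟨ cong (_+ⁿ length (s D)) (ℕ.*-identityʳ _) ⟩
        2 ^ length D +ⁿ length (s D) ∎)
      p≤ : length p ≤ occurrence-bound D
      p≤ = begin
        length p                     ≤⟨ ℕ.m≤m+n (length p) (length c′) ⟩
        length p +ⁿ length c′        ≡⟨ length-++ p ⟨
        length (p ++ c′)             ≡⟨ cong length cs≡ ⟨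
        length (c ++ s D)            ≡⟨ length-++ c ⟩
        length c +ⁿ length (s D)     ≤⟨ ℕ.+-monoˡ-≤ (length (s D)) (ℕ.m≤n+m (length c) (length l)) ⟩
        length l +ⁿ length c +ⁿ length (s D) ≡⟨ cong (_+ⁿ length (s D)) (length-++ l) ⟨
        length (l ++ c) +ⁿ length (s D) ≡⟨ cong (λ z → length z +ⁿ length (s D)) t≡ ⟨
        length t +ⁿ length (s D)     ≤⟨ ℕ.+-monoˡ-≤ (length (s D)) t-length ⟩
        occurrence-bound D ∎

-- Words acting injectively on a finite set.

power : {A : Set} → ℕ → List A → List A
power n w = concat (replicate n w)

module _ {A : Set} {d : ℕ} where

  run : (A → Fin d → Fin d) → Fin d → List A → Fin d
  run f v []      = v
  run f v (a ∷ w) = run f (f a v) w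

  InjectiveAction : (A → Fin d → Fin d) → Set
  InjectiveAction f = ∀ a {u v} → f a u ≡ f a v → u ≡ v

  run-++ : ∀ f v w w′ → run f v (w ++ w′) ≡ run f (run f v w) w′
  run-++ f v []      w′ = refl
  run-++ f v (a ∷ w) w′ = run-++ f (f a v) w w′

  run-injective : ∀ {f} → InjectiveAction f → ∀ w {u v} → run f u w ≡ run f v w → u ≡ v
  run-injective inj []      e = e
  run-injective inj (a ∷ w) e = inj a (run-injective inj w e)

  run-power-+ : ∀ f w m n v → run f v (power (m +ⁿ n) w) ≡ run f (run f v (power m w)) (power n w)
  run-power-+ f w zero    n v = refl
  run-power-+ f w (suc m) n v = begin
    run f v (w ++ power (m +ⁿ n) w)               ≡⟨ run-++ f v w _ ⟩
    run f (run f v w) (power (m +ⁿ n) w)          ≡⟨ run-power-+ f w m n _ ⟩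
    run f (run f (run f v w) (power m w)) (power n w) ≡⟨ cong (λ u → run f u (power n w)) (run-++ f v w _) ⟨
    run f (run f v (power (suc m) w)) (power n w) ∎
    where open ≡-Reasoning

  abstract
    -- Two of the first `d ^ d + 1` powers of `w` induce the same map, and injectivity cancels the
    -- smaller one.
    finite-order : ∀ {f} → InjectiveAction f → ∀ w → ∃[ n ] (∀ v → run f v (power (suc n) w) ≡ v)
    finite-order {f} inj w with pigeonhole (ℕ.n<1+n (d ^ d)) (λ j → funToFin {d} {d} (λ v → run f v (power (toℕ j) w)))
    ... | i , j , i<j , e with ℕ.m≤n⇒∃[o]m+o≡n i<j
    ...   | n , i+n≡j = n , λ v → sym (run-injective inj (power (toℕ i) w) (begin
      run f v (power (toℕ i) w)                         ≡⟨ finToFun-funToFin (λ v → run f v (power (toℕ i) w)) v ⟨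
      finToFun (funToFin (λ v → run f v (power (toℕ i) w))) v ≡⟨ cong (λ z → finToFun {d} {d} z v) e ⟩
      finToFun (funToFin (λ v → run f v (power (toℕ j) w))) v ≡⟨ finToFun-funToFin (λ v → run f v (power (toℕ j) w)) v ⟩
      run f v (power (toℕ j) w)                         ≡⟨ cong (λ m → run f v (power m w)) (trans (sym i+n≡j) (cong suc (ℕ.+-comm (toℕ i) n))) ⟩
      run f v (power (suc n +ⁿ toℕ i) w)                ≡⟨ run-power-+ f w (suc n) (toℕ i) v ⟩
      run f (run f v (power (suc n) w)) (power (toℕ i) w) ∎))
      where open ≡-Reasoning

  power-fixes : ∀ {f w} → (∀ v → run f v w ≡ v) → ∀ n v → run f v (power n w) ≡ v
  power-fixes         h zero    v = refl
  power-fixes {f} {w} h (suc n) v = trans (run-++ f v w _) (trans (power-fixes h n _) (h v))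

  abstract
    inverse-word : ∀ {f} → InjectiveAction f → ∀ w →
      ∃[ w⁻ ] (∀ v → run f (run f v w) w⁻ ≡ v) × (∀ v → run f (run f v w⁻) w ≡ v)
    inverse-word {f} inj w with finite-order inj w
    ... | n , h = power n w , left , λ v → run-injective inj (power n w) (left _)
      where
      left : ∀ v → run f (run f v w) (power n w) ≡ v
      left v = trans (sym (run-++ f v w _)) (h v)

-- Realising every permutation by an episturmian image.

module Realisation {k d : ℕ} where
  open Episturmian (_≟ᶠ_ {k}) public

  private
    A = Fin k

  induced : A → (A → Fin d → Fin d) → (A → Fin d → Fin d)
  induced i f j v = run f v (j ∷ pad i j)

  run-induced : ∀ i f v w → run (induced i f) v w ≡ run f v (ψ i w)
  run-induced i f v []      = refl
  run-induced i f v (j ∷ w) = trans (run-induced i f _ w) (sym (run-++ f (f j v) (pad i j) (ψ i w)))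

  induced-injective : ∀ i {f} → InjectiveAction f → InjectiveAction (induced i f)
  induced-injective i inj j = run-injective inj (j ∷ pad i j)

  -- ψ i extends to an automorphism of the free group, and inverses are powers in a finite group.
  abstract
    realise-ψ : ∀ i {f : A → Fin d → Fin d} → InjectiveAction f → ∀ w → ∃[ y ] (∀ v → run f v (ψ i y) ≡ run f v w)
    realise-ψ i {f} inj []      = [] , λ v → refl
    realise-ψ i {f} inj (j ∷ w) = let y , h = letter; y′ , h′ = realise-ψ i inj w in
      y ++ y′ , λ v → begin
        run f v (ψ i (y ++ y′))         ≡⟨ cong (run f v) (ψ-++ i y y′) ⟩
        run f v (ψ i y ++ ψ i y′)       ≡⟨ run-++ f v (ψ i y) _ ⟩
        run f (run f v (ψ i y)) (ψ i y′) ≡⟨ cong (λ u → run f u (ψ i y′)) (h v) ⟩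
        run f (f j v) (ψ i y′)          ≡⟨ h′ _ ⟩
        run f (f j v) w ∎
      where
      open ≡-Reasoning
      letter : ∃[ y ] (∀ v → run f v (ψ i y) ≡ f j v)
      letter with j ≟ᶠ i in eq
      ... | yes refl = [ i ] , λ v → cong (run f v) (ψ-self i [])
      -- The image of `j` is `j i`, so `z` only has to cancel the trailing `i`, which is
      -- `ψ i [ i ]`.
      ... | no  _ with inverse-word (induced-injective i inj) [ i ]
      ...   | z , h , _ = j ∷ z , λ v → begin
        run f v (ψ i (j ∷ z))                 ≡⟨ cong (λ u → run f (f j v) (u ++ ψ i z)) pad≡ ⟩
        run f (f i (f j v)) (ψ i z)           ≡⟨ run-induced i f _ z ⟨
        run (induced i f) (f i (f j v)) z     ≡⟨ cong (λ u → run (induced i f) u z)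
                                                   (trans (cong (run f (f j v)) (sym (ψ-self i []))) (sym (run-induced i f _ [ i ]))) ⟩
        run (induced i f) (run (induced i f) (f j v) [ i ]) z ≡⟨ h _ ⟩
        f j v ∎
        where
        pad≡ : pad i j ≡ [ i ]
        pad≡ rewrite eq = refl

  abstract
    -- Peels `D` from the outside: `w` is realised as some `ψ i y`, and then `y` under the action
    -- induced by `ψ i`, which is again injective.
    realise : ∀ D {f : A → Fin d → Fin d} → InjectiveAction f → ∀ w → ∃[ y ] (∀ v → run f v (φ D y) ≡ run f v w)
    realise []      inj w = w , λ v → refl
    realise (i ∷ D) {f} inj w with realise-ψ i inj w
    ... | y , h with realise D (induced-injective i inj) y
    ...   | y′ , h′ = y′ , λ v → begin
      run f v (ψ i (φ D y′))          ≡⟨ run-induced i f v (φ D y′) ⟨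
      run (induced i f) v (φ D y′)    ≡⟨ h′ v ⟩
      run (induced i f) v y           ≡⟨ run-induced i f v y ⟩
      run f v (ψ i y)                 ≡⟨ h v ⟩
      run f v w ∎
      where open ≡-Reasoning

-- Choosing `D` so that every path labelled `s D` visits `o`.

module Synchronisation {k d : ℕ} (f : Fin k → Fin d → Fin d) (f-inj : InjectiveAction f)
  (connected : ∀ u v → ∃[ w ] run f u w ≡ v) (o : Fin d) where
  open Realisation {k} {d}

  infixl 6 _▸_
  _▸_ : Fin d → List (Fin k) → Fin d
  _▸_ = run f

  data Hits (v : Fin d) : List (Fin k) → Set where
    here  : ∀ {w} → v ≡ o → Hits v w
    there : ∀ {a w} → Hits (f a v) w → Hits v (a ∷ w)

  hits? : ∀ v w → Dec (Hits v w)
  hits? v w with v ≟ᶠ o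
  ... | yes v≡o = yes (here v≡o)
  hits? v []      | no v≢o = no λ { (here e) → v≢o e }
  hits? v (a ∷ w) | no v≢o with hits? (f a v) w
  ...   | yes h = yes (there h)
  ...   | no ¬h = no λ { (here e) → v≢o e ; (there h) → ¬h h }

  Hits-++ʳ : ∀ t {v w} → Hits (v ▸ t) w → Hits v (t ++ w)
  Hits-++ʳ []      h = h
  Hits-++ʳ (a ∷ t) h = there (Hits-++ʳ t h)

  Hits-end : ∀ w {v} → v ▸ w ≡ o → Hits v w
  Hits-end w e = subst (Hits _) (++-identityʳ w) (Hits-++ʳ w (here e))

  Hits-split : ∀ {v w} → Hits v w → ∃[ c ] ∃[ r ] c ++ r ≡ w × v ▸ c ≡ o
  Hits-split {w = w} (here e) = [] , w , refl , e
  Hits-split (there {a} h)    = let c , r , e , e′ = Hits-split h in a ∷ c , r , cong (a ∷_) e , e′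

  -- Otherwise the endpoints of the paths labelled s D avoiding o would be closed under every φ D y,
  -- hence under the whole transitive group.
  avoiders-shrink : ∀ D u → ¬ Hits u (s D) → ∃[ i ] ∃[ u′ ] ¬ Hits u′ (s D) × Hits u′ (s (D ∷ʳ i))
  avoiders-shrink D u ¬h
    with any? (λ i → any? (λ u′ → ¬? (hits? u′ (s D)) ×-dec hits? u′ (s (D ∷ʳ i))))
  ... | yes found = found
  ... | no  none  = contradiction (Hits-end (s D) (trans e (trans (hy _) hw))) ¬h′
    where
    stable : ∀ i {u} → ¬ Hits u (s D) → ¬ Hits u (s (D ∷ʳ i))
    stable i ¬h h = none (i , _ , ¬h , h)

    closed : ∀ y {u} → ¬ Hits u (s D) → ∃[ u′ ] ¬ Hits u′ (s D) × u′ ▸ s D ≡ u ▸ s D ▸ φ D y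
    closed []      {u} ¬h = u , ¬h , cong (u ▸ s D ▸_) (sym (φ-[] D))
    -- Since `s (D ∷ʳ a)` is `t ++ s D`, an avoiding path for it from `u` has an avoiding last
    -- stretch `s D`, which starts at `u ▸ t` and ends at `u ▸ s D ▸ φ D [ a ]`.
    closed (a ∷ y) {u} ¬h with s-suffix D [ a ]
    ... | t , e with closed y {u ▸ t} (λ h → stable a ¬h (subst (Hits u) (trans e (sym (s-∷ʳ D a))) (Hits-++ʳ t h)))
    ...   | u′ , ¬h′ , e′ = u′ , ¬h′ , (begin
      u′ ▸ s D                        ≡⟨ e′ ⟩
      u ▸ t ▸ s D ▸ φ D y             ≡⟨ cong (_▸ φ D y) (run-++ f u t (s D)) ⟨
      u ▸ (t ++ s D) ▸ φ D y          ≡⟨ cong (λ z → u ▸ z ▸ φ D y) e ⟩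
      u ▸ (s D ++ φ D [ a ]) ▸ φ D y  ≡⟨ cong (_▸ φ D y) (run-++ f u (s D) _) ⟩
      u ▸ s D ▸ φ D [ a ] ▸ φ D y     ≡⟨ run-++ f (u ▸ s D) (φ D [ a ]) _ ⟨
      u ▸ s D ▸ (φ D [ a ] ++ φ D y)  ≡⟨ cong (u ▸ s D ▸_) (φ-++ D [ a ] y) ⟨
      u ▸ s D ▸ φ D (a ∷ y) ∎)
      where open ≡-Reasoning

    w = proj₁ (connected (u ▸ s D) o)
    hw = proj₂ (connected (u ▸ s D) o)
    y = proj₁ (realise D f-inj w)
    hy = proj₂ (realise D f-inj w)
    c = closed y ¬h
    ¬h′ = proj₁ (proj₂ c)
    e = proj₂ (proj₂ c)

  abstract
    -- As `s D` is a prefix of `s (D ∷ʳ i)`, lengthening `D` creates no new avoider, and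
    -- `avoiders-shrink` removes at least one; the covering list `vs` gets shorter.
    synchronising : ∃[ D ] (∀ v → Hits v (s D))
    synchronising = go (allFin d) (<-wellFounded _) [] (λ v _ → ∈-allFin v)
      where
      go : ∀ vs → Acc _<_ (length vs) → ∀ D → (∀ v → ¬ Hits v (s D) → v ∈ˡ vs) → ∃[ D ] (∀ v → Hits v (s D))
      go vs (acc rec) D cover with all? (λ v → hits? v (s D))
      ... | yes h = D , h
      ... | no ¬∀ with ¬∀⟶∃¬ d (λ v → Hits v (s D)) (λ v → hits? v (s D)) ¬∀
      ...   | u , ¬h with avoiders-shrink D u ¬h
      ...     | i , u′ , ¬h′ , h′ =
        go (filter P? vs) (rec (filter-notAll P? vs (lose (cover u′ ¬h′) (λ ¬p → ¬p h′)))) (D ∷ʳ i)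
           (λ v ¬hv → ∈-filter⁺ P? (cover v (λ h → ¬hv (monotone h))) ¬hv)
        where
        P? : ∀ v → Dec (¬ Hits v (s (D ∷ʳ i)))
        P? v = ¬? (hits? v (s (D ∷ʳ i)))

        Hits-++ˡ : ∀ {v w} w′ → Hits v w → Hits v (w ++ w′)
        Hits-++ˡ w′ (here e)  = here e
        Hits-++ˡ w′ (there h) = there (Hits-++ˡ w′ h)

        monotone : ∀ {v} → Hits v (s D) → Hits v (s (D ∷ʳ i))
        monotone h = subst (Hits _) (sym (s-∷ʳ D i)) (Hits-++ˡ _ h)

-- The code of first returns, its parses and its residuals.

Prefix⇒++ : {A : Set} {u v : List A} → Prefix _≡_ u v → ∃[ r ] u ++ r ≡ v
Prefix⇒++ {v = v} []    = v , refl
Prefix⇒++ (refl ∷ p)    = let r , e = Prefix⇒++ p in r , cong (_ ∷_) e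

Suffix⇒++ : {A : Set} {u v : List A} → Suffix _≡_ u v → ∃[ t ] t ++ u ≡ v
Suffix⇒++ (here e)        = [] , Pointwise-≡⇒≡ e
Suffix⇒++ (there {a} p)   = let t , e = Suffix⇒++ p in a ∷ t , cong (a ∷_) e

module FirstReturns {k d : ℕ} (f : Fin k → Fin d → Fin d) (f-inj : InjectiveAction f)
  (connected : ∀ u v → ∃[ w ] run f u w ≡ v) (o : Fin d)
  (D : List (Fin k)) (sync : ∀ v → Synchronisation.Hits f f-inj connected o v (Episturmian.s _≟ᶠ_ D)) where
  open Realisation {k} {d}
  open Synchronisation f f-inj connected o

  private
    A = Fin k

  ▸-++ : ∀ v w w′ → v ▸ (w ++ w′) ≡ v ▸ w ▸ w′
  ▸-++ = run-++ f

  NonReturning : List A → Set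
  NonReturning p = ∀ c r → c ++ r ≡ p → o ▸ c ≡ o → c ≡ []

  record X (w : List A) : Set where
    field
      factor-of  : F D w
      nonempty   : w ≢ []
      returns    : o ▸ w ≡ o
      first      : ∀ c r → c ++ r ≡ w → o ▸ c ≡ o → c ≡ [] ⊎ c ≡ w
  open X

  private
    L = X ⋆

  NonReturning-[] : NonReturning []
  NonReturning-[] c r e _ = ++-conicalˡ c r e

  ∷ʳ-NonReturning : ∀ {p a} → NonReturning p → o ▸ (p ∷ʳ a) ≢ o → NonReturning (p ∷ʳ a)
  ∷ʳ-NonReturning {p} nr ne c r e h with ++-≡-∷ʳ c r p e
  ... | inj₁ (refl , _) = contradiction h ne
  ... | inj₂ (r′ , e′)  = nr c r′ e′ h

  ∷ʳ≢[] : ∀ (p : List A) {a} → p ∷ʳ a ≢ []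
  ∷ʳ≢[] []      ()
  ∷ʳ≢[] (_ ∷ _) ()

  ∷ʳ-X : ∀ {p a} → NonReturning p → F D (p ∷ʳ a) → o ▸ (p ∷ʳ a) ≡ o → X (p ∷ʳ a)
  ∷ʳ-X {p} nr fpa ret = record
    { factor-of = fpa
    ; nonempty  = ∷ʳ≢[] p
    ; returns   = ret
    ; first     = first′
    }
    where
    first′ : ∀ c r → c ++ r ≡ p ∷ʳ _ → o ▸ c ≡ o → c ≡ [] ⊎ c ≡ p ∷ʳ _
    first′ c r e h with ++-≡-∷ʳ c r p e
    ... | inj₁ (e′ , _)  = inj₂ e′
    ... | inj₂ (r′ , e′) = inj₁ (nr c r′ e′ h)

  X-prefix : ∀ {u c} → c ≢ [] → X (u ++ c) → NonReturning u
  X-prefix {u} {c} c≢[] x c′ r refl h with first x c′ (r ++ c) (sym (++-assoc c′ r c)) h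
  ... | inj₁ e = e
  ... | inj₂ e with r | ++-identityʳ-unique c′ {r ++ c} (trans e (++-assoc c′ r c))
  ...   | [] | e′ = contradiction e′ c≢[]

  X-prefix-free : ∀ {u c} → X u → X (u ++ c) → c ≡ []
  X-prefix-free {u} {c} x y with first y u c refl (returns x)
  ... | inj₁ e = contradiction e (nonempty x)
  ... | inj₂ e = ++-identityʳ-unique u e

  -- Suffix-freeness rests on injectivity: if `t ++ u` and `u` both return to `o`, cancelling `u`
  -- shows that `t` returns too.
  isBifix : IsBifixCode X
  isBifix = record
    { nonempty    = λ x → nonempty x refl
    ; prefix-free = prefix-free
    ; suffix-free = suffix-free
    }
    where
    prefix-free : ∀ {u v} → X u → X v → ¬ ProperPrefix u v
    prefix-free {u} x y (p , u≢v) with Prefix⇒++ p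
    ... | r , refl = u≢v (sym (trans (cong (u ++_) (X-prefix-free x y)) (++-identityʳ u)))

    suffix-free : ∀ {u v} → X u → X v → ¬ ProperSuffix u v
    suffix-free {u} x y (p , u≢v) with Suffix⇒++ p
    ... | t , refl with first y t u refl (run-injective f-inj u
                         (trans (sym (▸-++ o t u)) (trans (returns y) (sym (returns x)))))
    ...   | inj₁ refl = u≢v refl
    ...   | inj₂ e    = nonempty x (++-identityʳ-unique t e)

  concat-returns : ∀ {xs} → All X xs → o ▸ concat xs ≡ o
  concat-returns []                = refl
  concat-returns {x ∷ xs} (p ∷ ps) =
    trans (▸-++ o x (concat xs)) (trans (cong (_▸ concat xs) (returns p)) (concat-returns ps))

  L-returns : ∀ {w} → L w → o ▸ w ≡ o
  L-returns (xs , all , refl) = concat-returns all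

  record Parse (u : List A) : Set where
    constructor parse
    field
      {xs}  : List (List A)
      {q}   : List A
      all   : All X xs
      eq    : concat xs ++ q ≡ u
      nr    : NonReturning q

    remainder-end : o ▸ q ≡ o ▸ u
    remainder-end = trans (cong (_▸ q) (sym (concat-returns all)))
      (trans (sym (▸-++ o (concat xs) q)) (cong (o ▸_) eq))

  parse-∷ : ∀ {x u} → X x → Parse u → Parse (x ++ u)
  parse-∷ {x} p (parse {xs} {q} all e nr) = parse (p ∷ all) (trans (++-assoc x (concat xs) q) (cong (x ++_) e)) nr

  -- Cuts at each return to `o`, with `p` the stretch since the last one. The pieces belong to `X`
  -- because `F D` is closed under factors.
  parse-F : ∀ p r → NonReturning p → F D (p ++ r) → Parse (p ++ r)
  parse-F p []      nr fp = parse [] (sym (++-identityʳ p)) nr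
  parse-F p (a ∷ r) nr fp with o ▸ (p ∷ʳ a) ≟ᶠ o | subst (F D) (sym (∷ʳ-++ p a r)) fp
  ... | yes e | fp′ = subst Parse (∷ʳ-++ p a r)
    (parse-∷ (∷ʳ-X nr (F-prefix (p ∷ʳ a) r fp′) e) (parse-F [] r NonReturning-[] (F-suffix (p ∷ʳ a) r fp′)))
  ... | no ¬e | fp′ = subst Parse (∷ʳ-++ p a r) (parse-F (p ∷ʳ a) r (∷ʳ-NonReturning nr ¬e) fp′)

  parse-concat : ∀ {ys} u {v} → All X ys → concat ys ≡ u ++ v → Parse u
  parse-concat u {v} [] e with ++-conicalˡ u v (sym e)
  ... | refl = parse [] refl NonReturning-[]
  parse-concat {y ∷ ys} u {v} (p ∷ ps) e with levi u v {y} {concat ys} (sym e)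
  ... | inj₂ (c , refl , e′) = parse-∷ p (parse-concat c ps e′)
  ... | inj₁ ([] , refl , _) = parse (subst X (++-identityʳ u) p ∷ [])
                                 (trans (++-identityʳ _) (++-identityʳ u)) NonReturning-[]
  ... | inj₁ (a ∷ c , refl , _) = parse [] refl (X-prefix (λ ()) p)

  parse-L : ∀ u {v} → L (u ++ v) → Parse u
  parse-L u (_ , all , e) = parse-concat u all e

  -- Left unitarity: the first code word of `x ++ r` and `x` are comparable prefixes, hence equal.
  L-cancel : ∀ {x r} → X x → L (x ++ r) → L r
  L-cancel {x} {r} p ([] , _ , e) = contradiction (++-conicalˡ x r (sym e)) (nonempty p)
  L-cancel {x} {r} p (y ∷ ys , q ∷ qs , e) with levi x r {y} {concat ys} (sym e)
  ... | inj₁ (c , refl , refl) with X-prefix-free p q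
  ...   | refl = ys , qs , refl
  L-cancel {x} {r} p (y ∷ ys , q ∷ qs , e) | inj₂ (c , refl , e′) with X-prefix-free q p
  ...   | refl = ys , qs , e′

  concat-cancel : ∀ {xs} q → All X xs → ((concat xs ++ q) ⁻¹∙ L) ≐ (q ⁻¹∙ L)
  concat-cancel         q []       = ≐-refl
  concat-cancel {x ∷ xs} q (p ∷ ps) = ≐-trans
    ( (λ {w} h → L-cancel p (subst L (reassoc w) h))
    , (λ {w} (ys , qs , e) → x ∷ ys , p ∷ qs , trans (cong (x ++_) e) (sym (reassoc w))))
    (concat-cancel q ps)
    where
    reassoc : ∀ w → ((x ++ concat xs) ++ q) ++ w ≡ x ++ (concat xs ++ q) ++ w
    reassoc w = trans (cong (_++ w) (++-assoc x (concat xs) q)) (++-assoc x (concat xs ++ q) w)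

  Parse-residual : ∀ {u} (h : Parse u) → (u ⁻¹∙ L) ≐ (Parse.q h ⁻¹∙ L)
  Parse-residual (parse {xs} {q} all refl nr) = concat-cancel q all

  record Special (q : List A) : Set where
    constructor special
    field
      nonReturning : NonReturning q
      suffix       : Suf q (s D)

  -- Every path labelled s D visits o, so s D occurs in a nonreturning word only as a prefix.
  s-occurs-first : ∀ l {r} → NonReturning (l ++ s D ++ r) → l ≡ []
  s-occurs-first l {r} nr with Hits-split (sync (o ▸ l))
  ... | c , r′ , e , h = ++-conicalˡ l c (nr (l ++ c) (r′ ++ r) eq (trans (▸-++ o l c) h))
    where
    open ≡-Reasoning
    eq : (l ++ c) ++ r′ ++ r ≡ l ++ s D ++ r
    eq = begin
      (l ++ c) ++ r′ ++ r ≡⟨ ++-assoc l c _ ⟩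
      l ++ c ++ r′ ++ r   ≡⟨ cong (l ++_) (++-assoc c r′ r) ⟨
      l ++ (c ++ r′) ++ r ≡⟨ cong (λ z → l ++ z ++ r) e ⟩
      l ++ s D ++ r ∎

  Suf-s : ∀ {q} → NonReturning q → Suf (s D) q → Suf q (s D)
  Suf-s nr (t , refl) with s-occurs-first t {[]} (subst (λ z → NonReturning (t ++ z)) (sym (++-identityʳ (s D))) nr)
  ... | refl = [] , refl

  -- A nonreturning word ending with `s D` is `s D` itself, by `s-occurs-first`, so `q` cannot be
  -- longer.
  special-suffix : ∀ {t q} c → NonReturning q → c ++ q ≡ t ++ s D → Special q
  special-suffix {t} {q} c nr e with levi c q {t} e
  ... | inj₁ (c′ , _ , e′) = special nr (Suf-s nr (c′ , sym e′))
  ... | inj₂ (c′ , _ , e′) = special nr (c′ , sym e′)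

  -- Of two suffixes of `s D` one ends with the other; by injectivity the extra beginning leads from
  -- `o` to `o`, so it is empty.
  special-unique : ∀ {q q′} → Special q → Special q′ → o ▸ q ≡ o ▸ q′ → q ≡ q′
  special-unique {q} {q′} (special nr (t , e)) (special nr′ (t′ , e′)) h with levi t q {t′} (trans e (sym e′))
  ... | inj₁ (c , _ , refl) with nr c q′ refl (run-injective f-inj q′ (trans (sym (▸-++ o c q′)) h))
  ...   | refl = refl
  special-unique {q} {q′} (special nr (t , e)) (special nr′ (t′ , e′)) h | inj₂ (c , _ , refl)
    with nr′ c q refl (run-injective f-inj q (trans (sym (▸-++ o c q)) (sym h)))
  ...   | refl = refl

  special-parse : ∀ {u t} → Suf u (t ++ s D) → (h : Parse u) → Special (Parse.q h)
  special-parse {t = t} (l , e) (parse {xs} {q} all refl nr) =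
    special-suffix {t} (l ++ concat xs) nr (trans (++-assoc l (concat xs) q) e)

  abstract
    -- The path labelled `s D` that ends at `v` visits `o`. What follows such a visit is cut at its
    -- returns; the remainder is a nonreturning suffix of `s D`.
    special-at : ∀ v → ∃[ q ] Special q × o ▸ q ≡ v
    special-at v with inverse-word f-inj (s D)
    ... | w , _ , h with Hits-split (sync (v ▸ w))
    ...   | c , r , e , hit = Parse.q pr , special-parse {t = []} (c , e) pr , (begin
        o ▸ Parse.q pr      ≡⟨ Parse.remainder-end pr ⟩
        o ▸ r               ≡⟨ cong (_▸ r) hit ⟨
        v ▸ w ▸ c ▸ r       ≡⟨ ▸-++ (v ▸ w) c r ⟨
        v ▸ w ▸ (c ++ r)    ≡⟨ cong (v ▸ w ▸_) e ⟩
        v ▸ w ▸ s D         ≡⟨ h v ⟩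
        v ∎)
      where
      open ≡-Reasoning
      pr : Parse r
      pr = parse-F [] r NonReturning-[] (Suf⇒F (c , e))

  P : Fin d → List A
  P v = proj₁ (special-at v)

  P-special : ∀ v → Special (P v)
  P-special v = proj₁ (proj₂ (special-at v))

  P-end : ∀ v → o ▸ P v ≡ v
  P-end v = proj₂ (proj₂ (special-at v))

  -- The first letter is set aside so that an occurrence of `s D` found in the rest is not initial,
  -- against `s-occurs-first`; this costs the `suc`.
  NonReturning-bound : ∀ p → F D p → NonReturning p → length p ≤ suc (occurrence-bound D)
  NonReturning-bound []      fp nr = z≤n
  NonReturning-bound (a ∷ p) fp nr with ℕ.<-≤-connex (occurrence-bound D) (length p)
  ... | inj₂ p≤ = s≤s p≤
  ... | inj₁ N< with s-occurs (F-suffix [ a ] p fp) N<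
  ...   | l , r , refl with s-occurs-first (a ∷ l) {r} nr
  ...     | ()

  abstract
    -- As a suffix of `s D ++ φ D y`, the word `P v ++ φ D y` lies in `F D` and can be parsed. Since
    -- `s D ++ φ D y` ends with `s D`, the remainder is special and known from its endpoint.
    P-move : ∀ v y → ((P v ++ φ D y) ⁻¹∙ L) ≐ (P (v ▸ φ D y) ⁻¹∙ L)
    P-move v y with s-suffix D y | P-special v
    ... | t , e | special nr (l , h) = subst (λ q → ((P v ++ φ D y) ⁻¹∙ L) ≐ (q ⁻¹∙ L))
        (special-unique (special-parse {t = t} (l , eq) pr) (P-special _) end) (Parse-residual pr)
      where
      open ≡-Reasoning
      pr : Parse (P v ++ φ D y)
      pr = parse-F (P v) (φ D y) nr (s-∈F (l , h) y)
      eq : l ++ P v ++ φ D y ≡ t ++ s D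
      eq = trans (sym (++-assoc l (P v) _)) (trans (cong (_++ φ D y) h) (sym e))
      end : o ▸ Parse.q pr ≡ o ▸ P (v ▸ φ D y)
      end = begin
        o ▸ Parse.q pr        ≡⟨ Parse.remainder-end pr ⟩
        o ▸ (P v ++ φ D y)    ≡⟨ ▸-++ o (P v) _ ⟩
        o ▸ P v ▸ φ D y       ≡⟨ cong (_▸ φ D y) (P-end v) ⟩
        v ▸ φ D y             ≡⟨ P-end _ ⟨
        o ▸ P (v ▸ φ D y) ∎

  abstract
    -- Here the parse comes from being a prefix of a word of `X ⋆` instead of from `F D`; the final
    -- `s D` again makes the remainder special.
    P-normal : ∀ u t {v} → L ((u ++ t ++ s D) ++ v) → ((u ++ t ++ s D) ⁻¹∙ L) ≐ (P (o ▸ (u ++ t ++ s D)) ⁻¹∙ L)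
    P-normal u t l = subst (λ q → ((u ++ t ++ s D) ⁻¹∙ L) ≐ (q ⁻¹∙ L))
        (special-unique (special-parse {t = u ++ t} ([] , sym (++-assoc u t (s D))) pr) (P-special _)
          (trans (Parse.remainder-end pr) (sym (P-end _))))
        (Parse-residual pr)
      where
      pr : Parse (u ++ t ++ s D)
      pr = parse-L (u ++ t ++ s D) l

  P-o : P o ≡ []
  P-o = special-unique (P-special o) (special NonReturning-[] (s D , ++-identityʳ (s D))) (P-end o)

  abstract
    P-satisfiable : ∀ v → ∃[ w ] L (P v ++ w)
    P-satisfiable v with connected v o
    ... | w , h with realise D f-inj w
    ...   | y , hy = φ D y , subst L (++-identityʳ _) (proj₂ (P-move v y)
        (subst (λ u → L (P u ++ [])) (sym (trans (hy v) h)) (subst (λ q → L (q ++ [])) (sym P-o) ([] , [] , refl))))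

-- Enumerating the code by its trie.

module _ {A : Set} where

  consAll : A → List (List A) → List (List A)
  consAll a = map (a ∷_)

module _ {n : ℕ} where

  branch : (Fin n → List (List (Fin n))) → List (List (Fin n))
  branch g = concat (tabulate (λ a → consAll a (g a)))

  ∈-branch⁺ : ∀ {g a w} → w ∈ˡ g a → (a ∷ w) ∈ˡ branch g
  ∈-branch⁺ {g} {a} h = ∈-concat⁺′ (∈-map⁺ (a ∷_) h) (∈-tabulate⁺ {f = λ a → consAll a (g a)} a)

  ∈-branch⁻ : ∀ {g w} → w ∈ˡ branch g → ∃[ a ] ∃[ v ] w ≡ a ∷ v × v ∈ˡ g a
  ∈-branch⁻ {g} h with ∈-concat⁻′ (tabulate (λ a → consAll a (g a))) h
  ... | _ , h₁ , h₂ with ∈-tabulate⁻ {f = λ a → consAll a (g a)} h₂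
  ...   | a , refl with ∈-map⁻ (a ∷_) h₁
  ...     | v , v∈ , refl = a , v , refl , v∈

  branch! : ∀ {g} → (∀ a → Unique (g a)) → Unique (branch g)
  branch! {g} h = Unique.concat⁺ (All.tabulate⁺ (λ a → Unique.map⁺ ∷-injectiveʳ (h a)))
    (AllPairs.tabulate⁺ λ {a} {b} a≢b (∈a , ∈b) → disjoint a≢b (∈-map⁻ (a ∷_) ∈a) (∈-map⁻ (b ∷_) ∈b))
    where
    disjoint : ∀ {a b} → a ≢ b → ∀ {v} → (∃[ x ] x ∈ˡ g a × v ≡ a ∷ x) → ¬ (∃[ x ] x ∈ˡ g b × v ≡ b ∷ x)
    disjoint a≢b (_ , _ , refl) (_ , _ , e) = a≢b (proj₁ (∷-injective e))

-- The counting relation of a trie is additive, so a forest of `n` tries has `n` in place of 1. With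
-- `n = k`, adding the parent as a branching node restores the 1.
length-concat-tabulate : ∀ {A : Set} n k (g h : Fin n → List A) →
  (∀ a → length (g a) +ⁿ length (h a) ≡ 1 +ⁿ k *ⁿ length (h a)) →
  length (concat (tabulate g)) +ⁿ length (concat (tabulate h)) ≡ n +ⁿ k *ⁿ length (concat (tabulate h))
length-concat-tabulate zero    k g h e = sym (ℕ.*-zeroʳ k)
length-concat-tabulate (suc n) k g h e = begin
  length (g zero ++ gs) +ⁿ length (h zero ++ hs)
    ≡⟨ cong₂ _+ⁿ_ (length-++ (g zero)) (length-++ (h zero)) ⟩
  (length (g zero) +ⁿ length gs) +ⁿ (length (h zero) +ⁿ length hs)
    ≡⟨ interchange (length (g zero)) _ _ _ ⟩
  (length (g zero) +ⁿ length (h zero)) +ⁿ (length gs +ⁿ length hs)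
    ≡⟨ cong₂ _+ⁿ_ (e zero) (length-concat-tabulate n k (g ∘ suc) (h ∘ suc) (e ∘ suc)) ⟩
  (1 +ⁿ k *ⁿ length (h zero)) +ⁿ (n +ⁿ k *ⁿ length hs)
    ≡⟨ collect k n (length (h zero)) (length hs) ⟩
  suc n +ⁿ k *ⁿ (length (h zero) +ⁿ length hs)
    ≡⟨ cong (λ l → suc n +ⁿ k *ⁿ l) (length-++ (h zero)) ⟨
  suc n +ⁿ k *ⁿ length (h zero ++ hs) ∎
  where
  open ≡-Reasoning
  gs = concat (tabulate (g ∘ suc))
  hs = concat (tabulate (h ∘ suc))
  interchange : ∀ a b c d → (a +ⁿ b) +ⁿ (c +ⁿ d) ≡ (a +ⁿ c) +ⁿ (b +ⁿ d)
  interchange = solve-∀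
  collect : ∀ k n a b → (1 +ⁿ k *ⁿ a) +ⁿ (n +ⁿ k *ⁿ b) ≡ suc n +ⁿ k *ⁿ (a +ⁿ b)
  collect = solve-∀

module Enumeration {k d : ℕ} (f : Fin k → Fin d → Fin d) (f-inj : InjectiveAction f)
  (connected : ∀ u v → ∃[ w ] run f u w ≡ v) (o : Fin d)
  (D : List (Fin k)) (sync : ∀ v → Synchronisation.Hits f f-inj connected o v (Episturmian.s _≟ᶠ_ D)) where
  open Realisation {k} {d}
  open Synchronisation f f-inj connected o
  open FirstReturns f f-inj connected o D sync

  private
    A = Fin k

  -- Words are stored as continuations of `p`. The field `count` is `leaves = 1 + (k - 1) specials`
  -- with the subtraction moved across, as `k` may be zero.
  record Trie (p : List A) : Set where
    field
      leaves specials     : List (List A)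
      leaves!             : Unique leaves
      specials!           : Unique specials
      leaf⁺               : ∀ {w} → X (p ++ w) → w ∈ˡ leaves
      leaf⁻               : ∀ {w} → w ∈ˡ leaves → X (p ++ w)
      special⁺            : ∀ {w} → Special (p ++ w) → w ∈ˡ specials
      special⁻            : ∀ {w} → w ∈ˡ specials → Special (p ++ w)
      count               : length leaves +ⁿ length specials ≡ 1 +ⁿ k *ⁿ length specials
  open Trie

  leaf-trie : ∀ {p} → X p → Trie p
  leaf-trie {p} x = record
    { leaves    = [ [] ]
    ; specials  = []
    ; leaves!   = [] AllPairs.∷ AllPairs.[]
    ; specials! = AllPairs.[]
    ; leaf⁺     = λ y → here (X-prefix-free x y)
    ; leaf⁻     = λ { (here refl) → subst X (sym (++-identityʳ p)) x }
    ; special⁺  = λ {w} sp → contradiction (Special.nonReturning sp p w refl (X.returns x)) (X.nonempty x)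
    ; special⁻  = λ ()
    ; count     = cong suc (sym (ℕ.*-zeroʳ k))
    }

  NonReturning-¬X : ∀ {p} → NonReturning p → ¬ X p
  NonReturning-¬X {p} nr x = X.nonempty x (nr p [] (++-identityʳ p) (X.returns x))

  special-trie : ∀ {p} → Special p → (∀ a → Trie (p ∷ʳ a)) → Trie p
  special-trie {p} sp t = record
    { leaves    = branch (λ a → leaves (t a))
    ; specials  = [] ∷ branch (λ a → specials (t a))
    ; leaves!   = branch! (λ a → leaves! (t a))
    ; specials! = All.tabulate (λ {_} v∈ → λ { refl → []∉ v∈ }) AllPairs.∷ branch! (λ a → specials! (t a))
    ; leaf⁺     = leaf⁺′
    ; leaf⁻     = leaf⁻′
    ; special⁺  = special⁺′
    ; special⁻  = special⁻′
    ; count     = count′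
    }
    where
    []∉ : [] ∉ˡ branch (λ a → specials (t a))
    []∉ h with ∈-branch⁻ h
    ... | _ , _ , () , _

    leaf⁺′ : ∀ {w} → X (p ++ w) → w ∈ˡ branch (λ a → leaves (t a))
    leaf⁺′ {[]}    x = contradiction (subst X (++-identityʳ p) x) (NonReturning-¬X (Special.nonReturning sp))
    leaf⁺′ {a ∷ w} x = ∈-branch⁺ (leaf⁺ (t a) (subst X (sym (∷ʳ-++ p a w)) x))

    leaf⁻′ : ∀ {w} → w ∈ˡ branch (λ a → leaves (t a)) → X (p ++ w)
    leaf⁻′ h with ∈-branch⁻ h
    ... | a , v , refl , v∈ = subst X (∷ʳ-++ p a v) (leaf⁻ (t a) v∈)

    special⁺′ : ∀ {w} → Special (p ++ w) → w ∈ˡ [] ∷ branch (λ a → specials (t a))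
    special⁺′ {[]}    x = here refl
    special⁺′ {a ∷ w} x = there (∈-branch⁺ (special⁺ (t a) (subst Special (sym (∷ʳ-++ p a w)) x)))

    special⁻′ : ∀ {w} → w ∈ˡ [] ∷ branch (λ a → specials (t a)) → Special (p ++ w)
    special⁻′ (here refl) = subst Special (sym (++-identityʳ p)) sp
    special⁻′ (there h) with ∈-branch⁻ h
    ... | a , v , refl , v∈ = subst Special (∷ʳ-++ p a v) (special⁻ (t a) v∈)

    open ≡-Reasoning
    ns = length (branch (λ a → specials (t a)))
    count′ : length (branch (λ a → leaves (t a))) +ⁿ suc ns ≡ 1 +ⁿ k *ⁿ suc ns
    count′ = begin
      length (branch (λ a → leaves (t a))) +ⁿ suc ns   ≡⟨ ℕ.+-suc _ ns ⟩
      suc (length (branch (λ a → leaves (t a))) +ⁿ ns) ≡⟨ cong suc (length-concat-tabulate k k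
          (λ a → consAll a (leaves (t a))) (λ a → consAll a (specials (t a)))
          (λ a → trans (cong₂ _+ⁿ_ (length-map (a ∷_) (leaves (t a))) (length-map (a ∷_) (specials (t a))))
                   (trans (count (t a)) (cong (λ l → suc (k *ⁿ l)) (sym (length-map (a ∷_) (specials (t a)))))))) ⟩
      suc (k +ⁿ k *ⁿ ns)                               ≡⟨ cong suc (ℕ.*-suc k ns) ⟨
      suc (k *ⁿ suc ns) ∎

  -- By `bispecial`, a second right extension would make `p` comparable with `s D`, and a
  -- nonreturning word of that kind is special. A single child changes neither number.
  unary-trie : ∀ {p a} → NonReturning p → ¬ Special p → F D (p ∷ʳ a) → Trie (p ∷ʳ a) → Trie p
  unary-trie {p} {a} nr ¬sp fpa t = record
    { leaves    = consAll a (leaves t)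
    ; specials  = consAll a (specials t)
    ; leaves!   = Unique.map⁺ ∷-injectiveʳ (leaves! t)
    ; specials! = Unique.map⁺ ∷-injectiveʳ (specials! t)
    ; leaf⁺     = leaf⁺′
    ; leaf⁻     = leaf⁻′
    ; special⁺  = special⁺′
    ; special⁻  = special⁻′
    ; count     = trans (cong₂ _+ⁿ_ (length-map (a ∷_) (leaves t)) (length-map (a ∷_) (specials t)))
                    (trans (count t) (cong (λ l → suc (k *ⁿ l)) (sym (length-map (a ∷_) (specials t)))))
    }
    where
    forced : ∀ {b w} → F D (p ++ b ∷ w) → b ≡ a
    forced {b} {w} fp with b ≟ᶠ a
    ... | yes e = e
    ... | no b≢a with bispecial D b≢a (F-prefix (p ∷ʳ b) w (subst (F D) (sym (∷ʳ-++ p b w)) fp)) fpa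
    ...   | inj₁ h = contradiction (special nr h) ¬sp
    ...   | inj₂ h = contradiction (special nr (Suf-s nr h)) ¬sp

    leaf⁺′ : ∀ {w} → X (p ++ w) → w ∈ˡ consAll a (leaves t)
    leaf⁺′ {[]}    x = contradiction (subst X (++-identityʳ p) x) (NonReturning-¬X nr)
    leaf⁺′ {b ∷ w} x with forced (X.factor-of x)
    ... | refl = ∈-map⁺ (b ∷_) (leaf⁺ t (subst X (sym (∷ʳ-++ p b w)) x))

    leaf⁻′ : ∀ {w} → w ∈ˡ consAll a (leaves t) → X (p ++ w)
    leaf⁻′ h with ∈-map⁻ (a ∷_) h
    ... | v , v∈ , refl = subst X (∷ʳ-++ p a v) (leaf⁻ t v∈)

    special⁺′ : ∀ {w} → Special (p ++ w) → w ∈ˡ consAll a (specials t)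
    special⁺′ {[]}    x = contradiction (subst Special (++-identityʳ p) x) ¬sp
    special⁺′ {b ∷ w} x with forced (Suf⇒F (Special.suffix x))
    ... | refl = ∈-map⁺ (b ∷_) (special⁺ t (subst Special (sym (∷ʳ-++ p b w)) x))

    special⁻′ : ∀ {w} → w ∈ˡ consAll a (specials t) → Special (p ++ w)
    special⁻′ h with ∈-map⁻ (a ∷_) h
    ... | v , v∈ , refl = subst Special (∷ʳ-++ p a v) (special⁻ t v∈)

  -- By `special-unique` the only candidate is `P` of the endpoint.
  special? : ∀ {p} → NonReturning p → Dec (Special p)
  special? {p} nr with ≡-dec _≟ᶠ_ (P (o ▸ p)) p
  ... | yes e = yes (subst Special e (P-special _))
  ... | no ¬e = no λ sp → ¬e (special-unique (P-special _) sp (P-end _))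

  private
    -- The empty word is special, so a nonspecial word supplies a letter even though the alphabet
    -- may be empty.
    some-letter : ∀ {p} → ¬ Special p → A
    some-letter {[]}    ¬sp = contradiction (special NonReturning-[] (s D , ++-identityʳ _)) ¬sp
    some-letter {a ∷ _} _   = a

  -- Each letter moves one unit of fuel from `n` to `length p`. With no fuel left, `p` has length at
  -- least `occurrence-bound D + 2`, one more than `NonReturning-bound` permits.
  trie : ∀ n {p} → occurrence-bound D +ⁿ 2 ≤ length p +ⁿ n → F D p → NonReturning p → Trie p
  trie zero {p} bound fp nr = contradiction
    (ℕ.≤-trans (ℕ.≤-reflexive (ℕ.+-comm 2 (occurrence-bound D)))
      (ℕ.≤-trans bound (ℕ.≤-trans (ℕ.≤-reflexive (ℕ.+-identityʳ (length p))) (NonReturning-bound p fp nr))))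
    (ℕ.1+n≰n)
  trie (suc n) {p} bound fp nr with special? nr
  ... | yes sp = special-trie sp (λ a → child a (Suf⇒F∷ʳ (Special.suffix sp) a))
    where
    child : ∀ a → F D (p ∷ʳ a) → Trie (p ∷ʳ a)
    child a fpa with o ▸ (p ∷ʳ a) ≟ᶠ o
    ... | yes e = leaf-trie (∷ʳ-X nr fpa e)
    ... | no ¬e = trie n (ℕ.≤-trans bound (ℕ.≤-reflexive (trans (ℕ.+-suc (length p) n)
                    (cong (_+ⁿ n) (sym (trans (length-++ p) (ℕ.+-comm (length p) 1))))))) fpa (∷ʳ-NonReturning nr ¬e)
  ... | no ¬sp with F-extend (some-letter ¬sp) fp
  ...   | a , fpa = unary-trie nr ¬sp fpa child
    where
    child : Trie (p ∷ʳ a)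
    child with o ▸ (p ∷ʳ a) ≟ᶠ o
    ... | yes e = leaf-trie (∷ʳ-X nr fpa e)
    ... | no ¬e = trie n (ℕ.≤-trans bound (ℕ.≤-reflexive (trans (ℕ.+-suc (length p) n)
                    (cong (_+ⁿ n) (sym (trans (length-++ p) (ℕ.+-comm (length p) 1))))))) fpa (∷ʳ-NonReturning nr ¬e)

  root : Trie []
  root = trie (occurrence-bound D +ⁿ 2) ℕ.≤-refl (Suf⇒F (s D , ++-identityʳ _)) NonReturning-[]

  P-injective : ∀ {u v} → P u ≡ P v → u ≡ v
  P-injective {u} {v} e = trans (sym (P-end u)) (trans (cong (o ▸_) e) (P-end v))

  specials-length : length (specials root) ≡ d
  specials-length = begin
    length (specials root)     ≡⟨ ↭-length (∼bag⇒↭ (unique∧set⇒bag (specials! root)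
                                    (Unique.map⁺ P-injective (Unique.allFin⁺ d)) (mk⇔ to from))) ⟩
    length (map P (allFin d))  ≡⟨ length-map P (allFin d) ⟩
    length (allFin d)          ≡⟨ length-tabulate {n = d} (λ i → i) ⟩
    d ∎
    where
    open ≡-Reasoning
    to : ∀ {q} → q ∈ˡ specials root → q ∈ˡ map P (allFin d)
    to h = subst (_∈ˡ map P (allFin d)) (special-unique (P-special _) (special⁻ root h) (P-end _)) (∈-map⁺ P (∈-allFin _))
    from : ∀ {q} → q ∈ˡ map P (allFin d) → q ∈ˡ specials root
    from h with ∈-map⁻ P h
    ... | v , _ , refl = special⁺ root (P-special v)

  cardinality : ∃[ n ] HasCard X n × + n ≡ (+ k - 1ℤ) * + d + 1ℤ
  cardinality = length (leaves root)
    , (leaves root , leaves! root , (λ w → mk⇔ (leaf⁺ root) (leaf⁻ root)) , refl)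
    , +-cancelʳ (+ d) _ _ (begin
      + (length (leaves root)) + + d            ≡⟨ ℤ.pos-+ (length (leaves root)) d ⟨
      + (length (leaves root) +ⁿ d)             ≡⟨ cong +_ leaves+d ⟩
      + (1 +ⁿ k *ⁿ d)                           ≡⟨ ℤ.pos-+ 1 (k *ⁿ d) ⟩
      1ℤ + + (k *ⁿ d)                           ≡⟨ cong (λ z → 1ℤ + z) (ℤ.pos-* k d) ⟩
      1ℤ + + k * + d                            ≡⟨ arith (+ k) (+ d) ⟩
      ((+ k - 1ℤ) * + d + 1ℤ) + + d ∎)
    where
    open ≡-Reasoning
    open import Algebra.Properties.Group (AbelianGroup.group ℤ.+-0-abelianGroup) using () renaming (∙-cancelʳ to +-cancelʳ)
    leaves+d : length (leaves root) +ⁿ d ≡ 1 +ⁿ k *ⁿ d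
    leaves+d = subst (λ m → length (leaves root) +ⁿ m ≡ 1 +ⁿ k *ⁿ m) specials-length (count root)
    arith : ∀ x y → 1ℤ + x * y ≡ ((x - 1ℤ) * y + 1ℤ) + y
    arith = solve-∀ᶻ

-- The maximal group around an idempotent.

module UnitsAt (M : Monoid 0ℓ 0ℓ) (e : Monoid.Carrier M)
  (idem : Monoid._≈_ M (Monoid._∙_ M e e) e) where
  private
    module M = Monoid M
  open Monoid M using (Carrier; _≈_; _∙_; ∙-cong; ∙-congˡ; ∙-congʳ; assoc)
  open import Relation.Binary.Reasoning.Setoid M.setoid

  -- The units of the monoid e M e.
  record Unit (m : Carrier) : Set where
    field
      left    : e ∙ m ≈ m
      right   : m ∙ e ≈ m
      n       : Carrier
      n-left  : e ∙ n ≈ n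
      n-right : n ∙ e ≈ n
      mn      : m ∙ n ≈ e
      nm      : n ∙ m ≈ e

  private
    mul-left : ∀ {x y} → e ∙ x ≈ x → e ∙ (x ∙ y) ≈ x ∙ y
    mul-left {x} {y} h = M.trans (M.sym (assoc e x y)) (∙-congʳ h)

    mul-right : ∀ {x y} → y ∙ e ≈ y → (x ∙ y) ∙ e ≈ x ∙ y
    mul-right {x} {y} h = M.trans (assoc x y e) (∙-congˡ h)

    cancel-middle : ∀ {x y y′ x′} → y ∙ y′ ≈ e → x ∙ e ≈ x → x ∙ x′ ≈ e → (x ∙ y) ∙ (y′ ∙ x′) ≈ e
    cancel-middle {x} {y} {y′} {x′} hy hx hxx = begin
      (x ∙ y) ∙ (y′ ∙ x′) ≈⟨ assoc x y _ ⟩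
      x ∙ (y ∙ (y′ ∙ x′)) ≈⟨ ∙-congˡ (assoc y y′ x′) ⟨
      x ∙ ((y ∙ y′) ∙ x′) ≈⟨ ∙-congˡ (∙-congʳ hy) ⟩
      x ∙ (e ∙ x′)        ≈⟨ assoc x e x′ ⟨
      (x ∙ e) ∙ x′        ≈⟨ ∙-congʳ hx ⟩
      x ∙ x′              ≈⟨ hxx ⟩
      e ∎

  open Unit

  e-unit : Unit e
  e-unit = record { left = idem ; right = idem ; n = e ; n-left = idem ; n-right = idem ; mn = idem ; nm = idem }

  resp : ∀ {x y} → x ≈ y → Unit x → Unit y
  resp h u = record
    { left    = M.trans (∙-congˡ (M.sym h)) (M.trans (left u) h)
    ; right   = M.trans (∙-congʳ (M.sym h)) (M.trans (right u) h)
    ; n       = n u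
    ; n-left  = n-left u
    ; n-right = n-right u
    ; mn      = M.trans (∙-congʳ (M.sym h)) (mn u)
    ; nm      = M.trans (∙-congˡ (M.sym h)) (nm u)
    }

  Unit-∙ : ∀ {x y} → Unit x → Unit y → Unit (x ∙ y)
  Unit-∙ u v = record
    { left    = mul-left (left u)
    ; right   = mul-right (right v)
    ; n       = n v ∙ n u
    ; n-left  = mul-left (n-left v)
    ; n-right = mul-right (n-right u)
    ; mn      = cancel-middle (mn v) (right u) (mn u)
    ; nm      = cancel-middle (nm u) (n-right v) (nm v)
    }

  inverse : ∀ {x} (u : Unit x) → Unit (n u)
  inverse {x} u = record
    { left = n-left u ; right = n-right u ; n = x ; n-left = left u ; n-right = right u ; mn = nm u ; nm = mn u }

  inverse-cong : ∀ {x y} (u : Unit x) (v : Unit y) → x ≈ y → n u ≈ n v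
  inverse-cong {x} {y} u v h = begin
    n u               ≈⟨ n-right u ⟨
    n u ∙ e           ≈⟨ ∙-congˡ (mn v) ⟨
    n u ∙ (y ∙ n v)   ≈⟨ assoc _ _ _ ⟨
    (n u ∙ y) ∙ n v   ≈⟨ ∙-congʳ (∙-congˡ h) ⟨
    (n u ∙ x) ∙ n v   ≈⟨ ∙-congʳ (nm u) ⟩
    e ∙ n v           ≈⟨ n-left v ⟩
    n v ∎

  unitGroup : Group 0ℓ 0ℓ
  unitGroup = record
    { Carrier = Σ Carrier Unit
    ; _≈_     = _≈_ on proj₁
    ; _∙_     = λ (x , u) (y , v) → x ∙ y , Unit-∙ u v
    ; ε       = e , e-unit
    ; _⁻¹     = λ (x , u) → n u , inverse u
    ; isGroup = record
      { isMonoid = record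
        { isSemigroup = record
          { isMagma = record
            { isEquivalence = On.isEquivalence proj₁ M.isEquivalence
            ; ∙-cong = ∙-cong
            }
          ; assoc = λ x y z → assoc (proj₁ x) (proj₁ y) (proj₁ z)
          }
        ; identity = (λ x → left (proj₂ x)) , (λ x → right (proj₂ x))
        }
      ; inverse = (λ x → nm (proj₂ x)) , (λ x → mn (proj₂ x))
      ; ⁻¹-cong = λ {x} {y} → inverse-cong (proj₂ x) (proj₂ y)
      }
    }

  groupIn : GroupIn M
  groupIn = record
    { Member   = Unit
    ; resp     = resp
    ; ∙-closed = Unit-∙
    ; group    = unitGroup
    ; φ        = id
    ; φ-iso    = record
      { isMagmaMonomorphism = record
        { isMagmaHomomorphism = record
          { isRelHomomorphism = record { cong = id }
          ; homo = λ x y → M.refl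
          }
        ; injective = id
        }
      ; surjective = λ x → x , id
      }
    }

  -- The only idempotent of a group is its identity, so a group containing `e` has unit `e`, and its
  -- elements are units of `e M e`.
  maximal : Maximal groupIn
  maximal Δ Γ⊆Δ {x} x∈ = record
    { left    = M.trans (∙-congʳ e≈unit) (unitˡ x∈)
    ; right   = M.trans (∙-congˡ e≈unit) (Δ.unitʳ x∈)
    ; n       = Δ.inv x∈
    ; n-left  = M.trans (∙-congʳ e≈unit) (unitˡ (Δ.inv∈ x∈))
    ; n-right = M.trans (∙-congˡ e≈unit) (Δ.unitʳ (Δ.inv∈ x∈))
    ; mn      = M.trans (Δ.invʳ x∈) (M.sym e≈unit)
    ; nm      = M.trans (Δ.invˡ x∈) (M.sym e≈unit)
    }
    where
    module Δ = GroupIn Δ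
    unitˡ : ∀ {y} (y∈ : Δ.Member y) → Δ.unit ∙ y ≈ y
    unitˡ {y} y∈ = begin
      Δ.unit ∙ y           ≈⟨ ∙-congʳ (Δ.invʳ y∈) ⟨
      (y ∙ Δ.inv y∈) ∙ y   ≈⟨ assoc _ _ _ ⟩
      y ∙ (Δ.inv y∈ ∙ y)   ≈⟨ ∙-congˡ (Δ.invˡ y∈) ⟩
      y ∙ Δ.unit           ≈⟨ Δ.unitʳ y∈ ⟩
      y ∎
    e∈ = Γ⊆Δ e-unit
    e≈unit : e ≈ Δ.unit
    e≈unit = begin
      e                       ≈⟨ unitˡ e∈ ⟨
      Δ.unit ∙ e              ≈⟨ ∙-congʳ (Δ.invˡ e∈) ⟨
      (Δ.inv e∈ ∙ e) ∙ e      ≈⟨ assoc _ _ _ ⟩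
      Δ.inv e∈ ∙ (e ∙ e)      ≈⟨ ∙-congˡ idem ⟩
      Δ.inv e∈ ∙ e            ≈⟨ Δ.invˡ e∈ ⟩
      Δ.unit ∎

-- Transitions of the minimal automaton as equalities of residuals.

module MinimalAutomaton {A : Set} (L : Pred (List A) 0ℓ) where
  open TransitionMonoid (minimalAutomaton L) public
  open Automaton (minimalAutomaton L) using (State) public

  residual-++ : ∀ {u v} w → (u ⁻¹∙ L) ≐ (v ⁻¹∙ L) → ((u ++ w) ⁻¹∙ L) ≐ ((v ++ w) ⁻¹∙ L)
  residual-++ {u} {v} w (h , h′) =
    (λ {x} l → subst L (sym (++-assoc v w x)) (h (subst L (++-assoc u w x) l))) ,
    (λ {x} l → subst L (sym (++-assoc u w x)) (h′ (subst L (++-assoc v w x) l)))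

  residual-≡ : ∀ {u v} → u ≡ v → (u ⁻¹∙ L) ≐ (v ⁻¹∙ L)
  residual-≡ refl = ≐-refl

  ↦⇒≐ : ∀ {q r w} → q · w ↦ r → ((proj₁ q ++ w) ⁻¹∙ L) ≐ (proj₁ r ⁻¹∙ L)
  ↦⇒≐ {q} ([] e) = ≐-trans (residual-≡ (++-identityʳ (proj₁ q))) e
  ↦⇒≐ {q} {r} (_∷_ {s = q′} {a = a} {w = w} t p) = ≐-trans (residual-≡ (sym (∷ʳ-++ (proj₁ q) a w)))
    (≐-trans (residual-++ w t) (↦⇒≐ {q′} {r} p))

  -- States are nonempty residuals, so each intermediate one needs a witness: a word `x` of the
  -- final residual gives `w ++ x`.
  ≐⇒↦ : ∀ {q r} w → ((proj₁ q ++ w) ⁻¹∙ L) ≐ (proj₁ r ⁻¹∙ L) → q · w ↦ r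
  ≐⇒↦ {q} []      h = [] (≐-trans (residual-≡ (sym (++-identityʳ (proj₁ q)))) h)
  ≐⇒↦ {u , _} {v , x , l} (a ∷ w) h = _∷_ {s = q′} ≐-refl (≐⇒↦ {q′} w (≐-trans (residual-≡ (∷ʳ-++ u a w)) h))
    where
    q′ : State
    q′ = u ∷ʳ a , w ++ x , subst L (trans (++-assoc u (a ∷ w) x) (sym (∷ʳ-++ u a (w ++ x)))) (proj₂ h l)

  ≋-intro : ∀ {v w} →
    (∀ u → Satisfiable ((u ++ v) ⁻¹∙ L) ⊎ Satisfiable ((u ++ w) ⁻¹∙ L) → ((u ++ v) ⁻¹∙ L) ≐ ((u ++ w) ⁻¹∙ L)) → v ≋ w
  ≋-intro {v} {w} h {q} {r} = mk⇔
    (λ p → let i = ↦⇒≐ {q} {r} p in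
      ≐⇒↦ {q} {r} w (≐-trans (≐-sym (h (proj₁ q) (inj₁ (satisfied i)))) i))
    (λ p → let i = ↦⇒≐ {q} {r} p in
      ≐⇒↦ {q} {r} v (≐-trans (h (proj₁ q) (inj₂ (satisfied i))) i))
    where
    satisfied : ∀ {z} → (z ⁻¹∙ L) ≐ (proj₁ r ⁻¹∙ L) → Satisfiable (z ⁻¹∙ L)
    satisfied i = proj₁ (proj₂ r) , proj₂ i (proj₂ (proj₂ r))

-- The syntactic group of the code.

module Syntactic {k d : ℕ} (f : Fin k → Fin d → Fin d) (f-inj : InjectiveAction f)
  (connected : ∀ u v → ∃[ w ] run f u w ≡ v) (o : Fin d)
  (D : List (Fin k)) (sync : ∀ v → Synchronisation.Hits f f-inj connected o v (Episturmian.s _≟ᶠ_ D)) where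
  open Realisation {k} {d}
  open Synchronisation f f-inj connected o
  open FirstReturns f f-inj connected o D sync

  private
    A = Fin k
    L = X ⋆
  open MinimalAutomaton L

  φ-power : ∀ D n w → φ D (power n w) ≡ power n (φ D w)
  φ-power D zero    w = φ-[] D
  φ-power D (suc n) w = trans (φ-++ D w _) (cong (φ D w ++_) (φ-power D n w))

  length-power : ∀ n {a : A} {z} → n ≤ length (power n (a ∷ z))
  length-power zero    = z≤n
  length-power (suc n) {a} {z} = s≤s (ℕ.≤-trans (length-power n)
    (ℕ.≤-trans (ℕ.m≤n+m _ (length z)) (ℕ.≤-reflexive (sym (length-++ z)))))

  -- Ending with `s D` sends every state on which the word is defined to some `P v`; fixing all
  -- points keeps its endpoint.
  record Idempotent : Set where
    field
      yₑ tₑ : List A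
      ends  : φ D yₑ ≡ tₑ ++ s D
      fixes : ∀ v → v ▸ φ D yₑ ≡ v

  abstract
    idempotent : Idempotent
    idempotent = build D refl
      where
      build : ∀ D′ → D ≡ D′ → Idempotent
      -- Here `s D` is empty, so the empty word serves, even over the empty alphabet; otherwise `D`
      -- supplies a letter.
      build [] refl = record { yₑ = [] ; tₑ = [] ; ends = refl ; fixes = λ v → refl }
      build (i ∷ _) _ with φ-∷ D i []
      ... | z , e with finite-order f-inj (φ D [ i ])
      ...   | n , h = record { yₑ = yₑ ; tₑ = proj₁ suffix ; ends = proj₂ suffix ; fixes = fixes }
        where
        N : ℕ
        N = length (s D)
        -- The exponent `suc n` makes the action trivial; `N` copies make the image at least as long
        -- as `s D`, which is then its suffix.
        y₁ yₑ : List A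
        y₁ = power (suc n) [ i ]
        yₑ = power N y₁

        fixes : ∀ v → v ▸ φ D yₑ ≡ v
        fixes v = trans (cong (v ▸_) (φ-power D N y₁))
          (power-fixes {f = f} (λ u → trans (cong (u ▸_) (φ-power D (suc n) [ i ])) (h u)) N v)

        long : N ≤ length (φ D yₑ)
        long = subst (N ≤_) (cong length (sym (trans (φ-power D N y₁)
          (cong (power N) (trans (φ-++ D [ i ] (power n [ i ])) (cong (_++ φ D (power n [ i ])) e)))))) (length-power N)

        suffix : ∃[ t ] φ D yₑ ≡ t ++ s D
        suffix with s-suffix D yₑ
        ... | t , e₁ with levi (s D) (φ D yₑ) {t} {s D} (sym e₁)
        ...   | inj₁ (c , _ , e₂) = c , e₂
        ...   | inj₂ ([] , _ , e₂) = [] , sym e₂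
        ...   | inj₂ (b ∷ c , _ , e₂) = contradiction
          (ℕ.≤-trans (s≤s (ℕ.≤-trans long (ℕ.m≤n+m _ (length c))))
            (ℕ.≤-reflexive (trans (cong suc (sym (length-++ c))) (sym (cong length e₂)))))
          ℕ.1+n≰n

  open Idempotent idempotent

  e : List A
  e = φ D yₑ

  abstract
    P-normal-e : ∀ u {v} → L ((u ++ e) ++ v) → ((u ++ e) ⁻¹∙ L) ≐ (P (o ▸ u) ⁻¹∙ L)
    P-normal-e u {v} l = subst (λ x → ((u ++ e) ⁻¹∙ L) ≐ (P x ⁻¹∙ L)) (trans (▸-++ o u e) (fixes _))
      (subst (λ z → ((u ++ z) ⁻¹∙ L) ≐ (P (o ▸ (u ++ z)) ⁻¹∙ L)) (sym ends)
        (P-normal u tₑ (subst (λ z → L ((u ++ z) ++ v)) ends l)))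

  abstract
    e-move : ∀ u y {v} → L ((u ++ e) ++ v) → ((u ++ e ++ φ D y) ⁻¹∙ L) ≐ (P (o ▸ u ▸ φ D y) ⁻¹∙ L)
    e-move u y l = ≐-trans (residual-≡ (sym (++-assoc u e (φ D y))))
      (≐-trans (residual-++ (φ D y) (P-normal-e u l)) (P-move (o ▸ u) y))

  abstract
    -- Where defined, `e` resets a state to the `P v` with the same endpoint, after which `φ D y`
    -- acts only through its permutation.
    e-≋ : ∀ {y y′} → (∀ v → v ▸ φ D y ≡ v ▸ φ D y′) → (e ++ φ D y) ≋ (e ++ φ D y′)
    e-≋ {y} {y′} h = ≋-intro λ u sat → let w , l = reach u sat in
      ≐-trans (e-move u y l) (subst (λ v → (P v ⁻¹∙ L) ≐ ((u ++ e ++ φ D y′) ⁻¹∙ L)) (sym (h (o ▸ u)))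
        (≐-sym (e-move u y′ l)))
      where
      cut : ∀ u z w → L ((u ++ e ++ z) ++ w) → L ((u ++ e) ++ z ++ w)
      cut u z w = subst L (trans (cong (_++ w) (sym (++-assoc u e z))) (++-assoc (u ++ e) z w))
      reach : ∀ u → Satisfiable ((u ++ e ++ φ D y) ⁻¹∙ L) ⊎ Satisfiable ((u ++ e ++ φ D y′) ⁻¹∙ L) → ∃[ w ] L ((u ++ e) ++ w)
      reach u (inj₁ (w , l)) = _ , cut u (φ D y) w l
      reach u (inj₂ (w , l)) = _ , cut u (φ D y′) w l

  private
    module M = Monoid transitionMonoid

  abstract
    e-≋-e : ∀ {y} → (∀ v → v ▸ φ D y ≡ v) → (e ++ φ D y) ≋ e
    e-≋-e {y} h = M.trans (e-≋ {y} {[]} (λ v → trans (h v) (cong (v ▸_) (sym (φ-[] D)))))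
      (≡⇒≋ (trans (cong (e ++_) (φ-[] D)) (++-identityʳ e)))

  abstract
    e-idempotent : (e ++ e) ≋ e
    e-idempotent = e-≋-e fixes

  module U = UnitsAt transitionMonoid e e-idempotent

  Γ : GroupIn transitionMonoid
  Γ = U.groupIn

  abstract
    -- The inverse permutation is induced by some `φ D y′`, by `realise`. Through `e-≋` the monoid
    -- equations reduce to equations between permutations.
    φ-unit : ∀ y → U.Unit (e ++ φ D y)
    φ-unit y with inverse-word f-inj (φ D y)
    ... | w , hl , hr with realise D f-inj w
    ...   | y′ , h = record
      { left    = left y
      ; right   = right y
      ; n       = e ++ φ D y′
      ; n-left  = left y′
      ; n-right = right y′
      ; mn      = product y y′ (λ v → trans (h _) (hl v))
      ; nm      = product y′ y (λ v → trans (cong (_▸ φ D y) (h v)) (hr v))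
      }
      where
      left : ∀ y → (e ++ e ++ φ D y) ≋ (e ++ φ D y)
      left y = M.trans (≡⇒≋ (sym (++-assoc e e (φ D y)))) (M.∙-congʳ e-idempotent)

      right : ∀ y → ((e ++ φ D y) ++ e) ≋ (e ++ φ D y)
      right y = M.trans (≡⇒≋ (trans (++-assoc e (φ D y) e) (cong (e ++_) (sym (φ-++ D y yₑ)))))
        (e-≋ {y ++ yₑ} {y} (λ v → trans (cong (v ▸_) (φ-++ D y yₑ)) (trans (▸-++ v (φ D y) e) (fixes _))))

      product : ∀ y y′ → (∀ v → v ▸ φ D y ▸ φ D y′ ≡ v) → ((e ++ φ D y) ++ e ++ φ D y′) ≋ e
      product y y′ h = M.trans (≡⇒≋ eq) (e-≋-e {y ++ yₑ ++ y′} (λ v → begin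
        v ▸ φ D (y ++ yₑ ++ y′)       ≡⟨ cong (v ▸_) split ⟩
        v ▸ (φ D y ++ e ++ φ D y′)    ≡⟨ ▸-++ v (φ D y) _ ⟩
        v ▸ φ D y ▸ (e ++ φ D y′)     ≡⟨ ▸-++ (v ▸ φ D y) e _ ⟩
        v ▸ φ D y ▸ e ▸ φ D y′        ≡⟨ cong (_▸ φ D y′) (fixes _) ⟩
        v ▸ φ D y ▸ φ D y′            ≡⟨ h v ⟩
        v ∎))
        where
        open ≡-Reasoning
        split : φ D (y ++ yₑ ++ y′) ≡ φ D y ++ e ++ φ D y′
        split = trans (φ-++ D y _) (cong (φ D y ++_) (φ-++ D yₑ y′))
        eq : (e ++ φ D y) ++ e ++ φ D y′ ≡ e ++ φ D (y ++ yₑ ++ y′)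
        eq = trans (++-assoc e (φ D y) _) (cong (e ++_) (sym split))

  syntacticGroup : SyntacticGroup X
  syntacticGroup = record { Γ = Γ ; maximal = U.maximal }

  private
    module Im = Setoid (I Γ)

  vertex : Im.Carrier → Fin d
  vertex ((u , _) , _) = o ▸ u

  -- A common continuation leads both endpoints to `o`, and words act injectively.
  same-vertex : ∀ {u v} → Satisfiable (u ⁻¹∙ L) → (u ⁻¹∙ L) ≐ (v ⁻¹∙ L) → o ▸ u ≡ o ▸ v
  same-vertex {u} {v} (w , l) (h , _) = run-injective f-inj w
    (trans (sym (▸-++ o u w)) (trans (L-returns l) (trans (sym (L-returns (h l))) (▸-++ o v w))))

  vertex-cong : ∀ {x y} → x Im.≈ y → vertex x ≡ vertex y
  vertex-cong {(_ , sat) , _} h = same-vertex sat h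

  -- A state of the common image is fixed by `e`, hence equal to `P` of its vertex.
  vertex-injective : ∀ {x y} → vertex x ≡ vertex y → x Im.≈ y
  vertex-injective {x} {y} h = ≐-trans (normal x) (subst (λ v → (P v ⁻¹∙ L) ≐ (proj₁ (proj₁ y) ⁻¹∙ L)) (sym h) (≐-sym (normal y)))
    where
    normal : ∀ x → (proj₁ (proj₁ x) ⁻¹∙ L) ≐ (P (vertex x) ⁻¹∙ L)
    normal (q@(u , w , l) , q∈) = let i = ↦⇒≐ {q} {q} (fix Γ q∈) in
      ≐-trans (≐-sym i) (P-normal-e u (proj₂ i l))

  point : Fin d → Im.Carrier
  point v = state , e , U.e-unit , state , ≐⇒↦ {state} {state} e
    (≐-trans (P-move v yₑ) (residual-≡ (cong P (fixes v))))
    where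
    state : State
    state = P v , P-satisfiable v

  vertex-point : ∀ v → vertex (point v) ≡ v
  vertex-point = P-end

  vertex-act : ∀ {m} (m∈ : U.Unit m) x → vertex (_·⟨_⟩ Γ x m∈) ≡ vertex x ▸ m
  vertex-act {m} m∈ x = sym (trans (sym (▸-++ o (proj₁ (proj₁ x)) m)) (same-vertex sat i))
    where
    x′ = _·⟨_⟩ Γ x m∈
    i = ↦⇒≐ {proj₁ x} {proj₁ x′} (·⟨⟩-graph Γ x m∈)
    sat = proj₁ (proj₂ (proj₁ x′)) , proj₂ i (proj₂ (proj₂ (proj₁ x′)))

  label : Inverse (I Γ) (setoid (Fin d))
  label = record
    { to        = vertex
    ; from      = point
    ; to-cong   = λ {x} {y} → vertex-cong {x} {y}
    ; from-cong = λ { {u} refl → Im.refl {point u} }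
    ; inverse   =
        (λ {v} {x} h → trans (vertex-cong {x} {point v} h) (vertex-point v))
      , (λ {x} {v} h → vertex-injective {point v} {x} (trans (vertex-point v) h))
    }

  private
    H = SyntacticGroup.permutationGroup syntacticGroup

  realised : ∀ w → ∃[ h ] (∀ x → vertex (act H h x) ≡ vertex x ▸ w)
  realised w = (restriction Γ m∈ , _ , m∈ , λ x → ≐-refl) , λ x → begin
    vertex (_·⟨_⟩ Γ x m∈)      ≡⟨ vertex-act m∈ x ⟩
    vertex x ▸ (e ++ φ D y)    ≡⟨ ▸-++ (vertex x) e (φ D y) ⟩
    vertex x ▸ e ▸ φ D y       ≡⟨ cong (_▸ φ D y) (fixes (vertex x)) ⟩
    vertex x ▸ φ D y           ≡⟨ proj₂ (realise D f-inj w) (vertex x) ⟩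
    vertex x ▸ w ∎
    where
    open ≡-Reasoning
    y = proj₁ (realise D f-inj w)
    m∈ = φ-unit y

  covered : ∀ h → ∃[ w ] (∀ x → vertex (act H h x) ≡ vertex x ▸ w)
  covered h@(π , m , m∈ , e) = m , λ x →
    trans (sym (vertex-cong {_·⟨_⟩ Γ x m∈} {act H h x} (e x))) (vertex-act m∈ x)

-- Through `label`, the fields `realised` and `covered` say that `H` consists of exactly the
-- permutations induced by words.
record Construction {k d : ℕ} (f : Fin k → Fin d → Fin d) : Set₁ where
  field
    X              : Pred (List (Fin k)) 0ℓ
    isBifix        : IsBifixCode X
    cardinality    : ∃[ n ] HasCard X n × + n ≡ (+ k - 1ℤ) * + d + 1ℤ
    syntacticGroup : SyntacticGroup X

  open TransitionMonoid (minimalAutomaton (X ⋆)) using (I)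

  H : PermutationGroup (I (SyntacticGroup.Γ syntacticGroup)) 0ℓ
  H = SyntacticGroup.permutationGroup syntacticGroup

  field
    label    : Inverse (I (SyntacticGroup.Γ syntacticGroup)) (setoid (Fin d))
    realised : ∀ w → ∃[ h ] (∀ i → Inverse.to label (act H h i) ≡ run f (Inverse.to label i) w)
    covered  : ∀ h → ∃[ w ] (∀ i → Inverse.to label (act H h i) ≡ run f (Inverse.to label i) w)

module _ {k d : ℕ} (f : Fin k → Fin d → Fin d) (f-inj : InjectiveAction f)
  (connected : ∀ u v → ∃[ w ] run f u w ≡ v) (o : Fin d)
  (D : List (Fin k)) (sync : ∀ v → Synchronisation.Hits f f-inj connected o v (Episturmian.s _≟ᶠ_ D)) where

  construction-from : Construction f
  construction-from = record
    { X              = FirstReturns.X f f-inj connected o D sync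
    ; isBifix        = FirstReturns.isBifix f f-inj connected o D sync
    ; cardinality    = Enumeration.cardinality f f-inj connected o D sync
    ; syntacticGroup = Syntactic.syntacticGroup f f-inj connected o D sync
    ; label          = Syntactic.label f f-inj connected o D sync
    ; realised       = Syntactic.realised f f-inj connected o D sync
    ; covered        = Syntactic.covered f f-inj connected o D sync
    }

abstract
  construction : ∀ {k d} (f : Fin k → Fin d → Fin d) → InjectiveAction f →
    (∀ u v → ∃[ w ] run f u w ≡ v) → Fin d → Construction f
  construction f f-inj connected o = construction-from f f-inj connected o (proj₁ synchronising) (proj₂ synchronising)
    where open Synchronisation f f-inj connected o

-- Transfer to the given permutation group.

module Generated {r ℓ p : Level} {d k : ℕ} {R : Setoid r ℓ} (deg : HasDegree R d)
  (G : PermutationGroup R p) (transitive : Transitive G) (generated : GeneratedBy k (Subgroup.group G)) where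
  private
    module R = Setoid R
    module deg = Inverse deg
    module G = Group (Subgroup.group G)

  g : Fin k → G.Carrier
  g = proj₁ generated

  f : Fin k → Fin d → Fin d
  f a v = deg.to (act G (g a) (deg.from v))

  to-injective : ∀ {x y} → deg.to x ≡ deg.to y → x R.≈ y
  to-injective = Injection.injective (Inverse⇒Injection deg)

  act-cong : ∀ x {u v} → u R.≈ v → act G x u R.≈ act G x v
  act-cong x = Inverse.to-cong (proj₁ x)

  f-inj : InjectiveAction f
  f-inj a {u} {v} e = trans (sym (deg.strictlyInverseˡ u))
    (trans (deg.to-cong (Injection.injective (Inverse⇒Injection (proj₁ (g a))) (to-injective e))) (deg.strictlyInverseˡ v))

  Acts : G.Carrier → List (Fin k) → Set r
  Acts x w = ∀ u → deg.to (act G x u) ≡ run f (deg.to u) w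

  letter-acts : ∀ a → Acts (g a) [ a ]
  letter-acts a u = deg.to-cong (act-cong (g a) (R.sym (deg.strictlyInverseʳ u)))

  ∙-acts : ∀ {x y v w} → Acts x v → Acts y w → Acts (x G.∙ y) (v ++ w)
  ∙-acts {x} {y} {v} {w} hx hy u =
    trans (hy (act G x u)) (trans (cong (λ z → run f z w) (hx u)) (sym (run-++ f (deg.to u) v w)))

  word-acts : ∀ w → ∃[ x ] Acts x w
  word-acts []      = G.ε , λ u → refl
  word-acts (a ∷ w) = let x , h = word-acts w in g a G.∙ x , ∙-acts {g a} {x} {[ a ]} {w} (letter-acts a) h

  -- On a finite set, `inverse-word` turns inverses into positive words, so the generators already
  -- generate the group as a monoid.
  closure-word : ∀ {x} → Closure (Subgroup.group G) g x → ∃[ w ] Acts x w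
  closure-word (gen a) = [ a ] , letter-acts a
  closure-word one     = [] , λ u → refl
  closure-word (mul {x} {y} c c′) =
    let v , h = closure-word c; w , h′ = closure-word c′ in v ++ w , ∙-acts {x} {y} {v} {w} h h′
  closure-word (neg {x} c) with closure-word c
  ... | w , h with inverse-word f-inj w
  ...   | w⁻ , left , _ = w⁻ , λ u → begin
    deg.to (act G (x G.⁻¹) u)                           ≡⟨ left _ ⟨
    run f (run f (deg.to (act G (x G.⁻¹) u)) w) w⁻      ≡⟨ cong (λ z → run f z w⁻) (h _) ⟨
    run f (deg.to (act G x (act G (x G.⁻¹) u))) w⁻      ≡⟨ cong (λ z → run f z w⁻) (deg.to-cong (G.inverseˡ x u)) ⟩
    run f (deg.to u) w⁻ ∎
    where open ≡-Reasoning
  closure-word (conv e c) = let w , h = closure-word c in w , λ u → trans (deg.to-cong (R.sym (e u))) (h u)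

  element-word : ∀ x → ∃[ w ] Acts x w
  element-word x = closure-word (proj₂ generated x)

  connected : ∀ u v → ∃[ w ] run f u w ≡ v
  connected u v with transitive (deg.from u) (deg.from v)
  ... | x , e with element-word x
  ...   | w , h = w , (begin
    run f u w                          ≡⟨ cong (λ z → run f z w) (deg.strictlyInverseˡ u) ⟨
    run f (deg.to (deg.from u)) w      ≡⟨ h _ ⟨
    deg.to (act G x (deg.from u))      ≡⟨ deg.to-cong e ⟩
    deg.to (deg.from v)                ≡⟨ deg.strictlyInverseˡ v ⟩
    v ∎)
    where open ≡-Reasoning

  module Transfer {s ℓ′ p′ : Level} {S : Setoid s ℓ′} (H : PermutationGroup S p′)
    (label : Inverse S (setoid (Fin d)))
    (realised : ∀ w → ∃[ h ] (∀ i → Inverse.to label (act H h i) ≡ run f (Inverse.to label i) w))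
    (covered : ∀ h → ∃[ w ] (∀ i → Inverse.to label (act H h i) ≡ run f (Inverse.to label i) w)) where
    private
      module S = Setoid S
      module H = Group (Subgroup.group H)
      module label = Inverse label

    label-injective : ∀ {i j} → label.to i ≡ label.to j → i S.≈ j
    label-injective = Injection.injective (Inverse⇒Injection label)

    to : R.Carrier → S.Carrier
    to u = label.from (deg.to u)

    from : S.Carrier → R.Carrier
    from i = deg.from (label.to i)

    deg-from : ∀ i → deg.to (from i) ≡ label.to i
    deg-from i = deg.strictlyInverseˡ (label.to i)

    β : Inverse R S
    β = record
      { to        = to
      ; from      = from
      ; to-cong   = λ h → label.from-cong (deg.to-cong h)
      ; from-cong = λ h → deg.from-cong (label.to-cong h)
      ; inverse   =
          (λ {i} h → label-injective (trans (label.strictlyInverseˡ _) (trans (deg.to-cong h) (deg-from i))))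
        , (λ {u} h → R.trans (deg.from-cong (trans (label.to-cong h) (label.strictlyInverseˡ _))) (deg.strictlyInverseʳ u))
      }

    -- The word chosen for `x` is arbitrary, but by `σ-label` its effect depends on `x` alone.
    -- Permutations are compared pointwise, so all laws of `σ` follow from this.
    σ : G.Carrier → H.Carrier
    σ x = proj₁ (realised (proj₁ (element-word x)))

    σ-label : ∀ x i → label.to (act H (σ x) i) ≡ deg.to (act G x (from i))
    σ-label x i = begin
      label.to (act H (σ x) i)                  ≡⟨ proj₂ (realised w) i ⟩
      run f (label.to i) w                      ≡⟨ cong (λ v → run f v w) (deg-from i) ⟨
      run f (deg.to (from i)) w                 ≡⟨ proj₂ (element-word x) (from i) ⟨
      deg.to (act G x (from i)) ∎
      where
      open ≡-Reasoning
      w = proj₁ (element-word x)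

    σ-cong : ∀ {x y} → x G.≈ y → σ x H.≈ σ y
    σ-cong {x} {y} h i = label-injective (trans (σ-label x i) (trans (deg.to-cong (h (from i))) (sym (σ-label y i))))

    σ-homo : ∀ x y → σ (x G.∙ y) H.≈ (σ x H.∙ σ y)
    σ-homo x y i = label-injective (begin
      label.to (act H (σ (x G.∙ y)) i)                   ≡⟨ σ-label (x G.∙ y) i ⟩
      deg.to (act G y (act G x (from i)))                ≡⟨ deg.to-cong (act-cong y (deg.strictlyInverseʳ _)) ⟨
      deg.to (act G y (deg.from (deg.to (act G x (from i))))) ≡⟨ cong (λ v → deg.to (act G y (deg.from v))) (σ-label x i) ⟨
      deg.to (act G y (from (act H (σ x) i)))            ≡⟨ σ-label y (act H (σ x) i) ⟨
      label.to (act H (σ y) (act H (σ x) i)) ∎)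
      where open ≡-Reasoning

    σ-ε : σ G.ε H.≈ H.ε
    σ-ε i = label-injective (trans (σ-label G.ε i) (deg-from i))

    σ-⁻¹ : ∀ x → σ (x G.⁻¹) H.≈ (σ x H.⁻¹)
    σ-⁻¹ x = GroupProperties.inverseˡ-unique (Subgroup.group H) (σ (x G.⁻¹)) (σ x)
      (H.trans {σ (x G.⁻¹) H.∙ σ x} {σ (x G.⁻¹ G.∙ x)} {H.ε}
        (H.sym {σ (x G.⁻¹ G.∙ x)} {σ (x G.⁻¹) H.∙ σ x} (σ-homo (x G.⁻¹) x))
        (H.trans {σ (x G.⁻¹ G.∙ x)} {σ G.ε} {H.ε} (σ-cong {x G.⁻¹ G.∙ x} {G.ε} (G.inverseˡ x)) σ-ε))

    equivariant : ∀ u x → to (act G x u) S.≈ act H (σ x) (to u)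
    equivariant u x = label-injective (begin
      label.to (to (act G x u))        ≡⟨ label.strictlyInverseˡ _ ⟩
      deg.to (act G x u)               ≡⟨ deg.to-cong (act-cong x (Inverse.strictlyInverseʳ β u)) ⟨
      deg.to (act G x (from (to u)))   ≡⟨ σ-label x (to u) ⟨
      label.to (act H (σ x) (to u)) ∎)
      where open ≡-Reasoning

    σ-injective : ∀ {x y} → σ x H.≈ σ y → x G.≈ y
    σ-injective {x} {y} h u = Injection.injective (Inverse⇒Injection β)
      (S.trans (equivariant u x) (S.trans (h (to u)) (S.sym (equivariant u y))))

    σ-surjective : ∀ y → ∃[ x ] (∀ {z} → z G.≈ x → σ z H.≈ y)
    σ-surjective y = x , λ {z} z≈x i → label-injective (begin
        label.to (act H (σ z) i)        ≡⟨ σ-label z i ⟩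
        deg.to (act G z (from i))       ≡⟨ deg.to-cong (z≈x (from i)) ⟩
        deg.to (act G x (from i))       ≡⟨ proj₂ (word-acts w) (from i) ⟩
        run f (deg.to (from i)) w       ≡⟨ cong (λ v → run f v w) (deg-from i) ⟩
        run f (label.to i) w            ≡⟨ proj₂ (covered y) i ⟨
        label.to (act H y i) ∎)
      where
      open ≡-Reasoning
      w = proj₁ (covered y)
      x = proj₁ (word-acts w)

    equivalent : Equivalent G H
    equivalent = record
      { β           = β
      ; σ           = σ
      ; σ-iso       = record
        { isGroupMonomorphism = record
          { isGroupHomomorphism = record
            { isMonoidHomomorphism = record
              { isMagmaHomomorphism = record
                { isRelHomomorphism = record { cong = λ {x} {y} → σ-cong {x} {y} }
                ; homo = σ-homo
                }
              ; ε-homo = σ-ε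
              }
            ; ⁻¹-homo = σ-⁻¹
            }
          ; injective = λ {x} {y} → σ-injective {x} {y}
          }
        ; surjective = σ-surjective
        }
      ; equivariant = equivariant
      }

mainTheorem20 : ∀ {r ℓ p : Level} (d k : ℕ) .{{_ : NonZero d}} (R : Setoid r ℓ) → HasDegree R d →
    (G : PermutationGroup R p) → Transitive G → GeneratedBy k (Subgroup.group G) →
    Σ[ A ∈ Set ] (A ↔ Fin k) × (Σ[ X ∈ Pred (List A) 0ℓ ] IsBifixCode X ×
      (∃[ n ] HasCard X n × + n ≡ (+ k - 1ℤ) * + d + 1ℤ) ×
      (Σ[ S ∈ SyntacticGroup X ] Equivalent G (SyntacticGroup.permutationGroup S)))
mainTheorem20 d k R deg G transitive generated =
  Fin k , ↔-id (Fin k) , X , isBifix , cardinality , syntacticGroup , Transfer.equivalent H label realised covered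
  where
  open Generated deg G transitive generated
  -- A nonzero degree provides the base point `o`; any point would serve.
  open Construction (construction f f-inj connected (fromℕ< (>-nonZero⁻¹ d)))
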